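{- For all integers $n\geq 0$ and all integers $k$ with $1\leq k\leq 10$, $$B_{2,8}(8(11n+k)+7)\equiv 0\pmod{11}.$$
   Context: For integers $l,m>1$, an $l$-regular partition is a partition none of whose parts is divisible by $l$. A $(l,m)$-regular bipartition of $n$ is a pair of partitions $(\lambda,\mu)$ such that the sum of all parts of $\lambda$ and $\mu$ is $n$, $\lambda$ is $l$-regular and $\mu$ is $m$-regular. $B_{l,m}(n)$ denotes the number of $(l,m)$-regular bipartitions of $n$; equivalently $\sum_{n\ge 0}B_{l,m}(n)q^n=\frac{f_lf_m}{f_1^2}$, where $f_k=\prod_{j\ge1}(1-q^{jk})$. -}

module Defs where

open import Data.List.Base
  using (List; []; _∷_; length; filter; upTo; cartesianProduct; cartesianProductWith)
open import Data.List.Membership.Propositional using (_∈_)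
open import Data.List.Membership.Propositional.Properties
  using (∈-filter⁺; ∈-filter⁻; ∈-upTo⁺; ∈-cartesianProduct⁺; ∈-cartesianProductWith⁺; ∈-cartesianProductWith⁻)
open import Data.List.Properties using (∷-injective)
open import Data.List.Relation.Unary.All as All using (All; []; _∷_; all?)
open import Data.List.Relation.Unary.AllPairs using ([]; _∷_)
open import Data.List.Relation.Unary.Any using (here; there)
open import Data.List.Relation.Unary.Linked using (Linked; linked?)
open import Data.List.Relation.Unary.Unique.Propositional using (Unique)
import Data.List.Relation.Unary.Unique.Propositional.Properties as Unique
open import Data.Nat.Base using (ℕ; zero; suc; _+_; _≤_; _<_; _≥_; z≤n; s≤s)
open import Data.Nat.Divisibility using (_∣_; _∣?_)
open import Data.Nat.ListAction using (sum)
open import Data.Nat.Properties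
  using (_≟_; _<?_; _≥?_; ≤-trans; ≤-reflexive; m≤m+n; m≤n+m; +-mono-≤)
open import Data.Product.Base using (_×_; _,_; proj₂)
open import Function.Bundles using (_⇔_; mk⇔)
open import Relation.Binary.PropositionalEquality using (_≡_; _≢_; refl)
open import Relation.Nullary.Decidable using (_×-dec_; ¬?)
open import Relation.Nullary.Negation using (¬_)
open import Relation.Unary using (Decidable)

-- A partition is represented by the list of its parts in weakly decreasing
-- order, so that distinct partitions are distinct lists.

IsPartition : List ℕ → Set
IsPartition ps = All (0 <_) ps × Linked _≥_ ps

IsRegular : ℕ → List ℕ → Set
IsRegular l ps = All (λ p → ¬ l ∣ p) ps

IsRegularBipartition : (l m n : ℕ) → List ℕ × List ℕ → Set
IsRegularBipartition l m n (ps , qs) =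
  (IsPartition ps × IsRegular l ps) ×
  (IsPartition qs × IsRegular m qs) ×
  sum ps + sum qs ≡ n

isPartition? : Decidable IsPartition
isPartition? ps = all? (0 <?_) ps ×-dec linked? _≥?_ ps

isRegular? : ∀ l → Decidable (IsRegular l)
isRegular? l = all? (λ p → ¬? (l ∣? p))

isRegularBipartition? : ∀ l m n → Decidable (IsRegularBipartition l m n)
isRegularBipartition? l m n (ps , qs) =
  (isPartition? ps ×-dec isRegular? l ps) ×-dec
  (isPartition? qs ×-dec isRegular? m qs) ×-dec
  (sum ps + sum qs ≟ n)

-- All lists of length at most k with entries at most n.

boundedLists : (k n : ℕ) → List (List ℕ)
boundedLists zero    n = [] ∷ []
boundedLists (suc k) n = [] ∷ cartesianProductWith _∷_ (upTo (suc n)) (boundedLists k n)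

-- A partition with sum at most n has at most n parts, each at most n, so
-- this finite search space misses no bipartition of n; see
-- ∈-regularBipartitions and regularBipartitions-unique.

regularBipartitions : (l m n : ℕ) → List (List ℕ × List ℕ)
regularBipartitions l m n =
  filter (isRegularBipartition? l m n)
         (cartesianProduct (boundedLists n n) (boundedLists n n))

B : (l m n : ℕ) → ℕ
B l m n = length (regularBipartitions l m n)

∈-boundedLists : ∀ {k n ps} → length ps ≤ k → All (_≤ n) ps → ps ∈ boundedLists k n
∈-boundedLists {zero}  z≤n      []       = here refl
∈-boundedLists {suc k} z≤n      []       = here refl
∈-boundedLists {suc k} (s≤s le) (p ∷ ps) =
  there (∈-cartesianProductWith⁺ _∷_ (∈-upTo⁺ (s≤s p)) (∈-boundedLists le ps))

boundedLists-unique : ∀ k n → Unique (boundedLists k n)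
boundedLists-unique zero    n = [] ∷ []
boundedLists-unique (suc k) n =
  All.tabulate nonempty ∷
  Unique.cartesianProductWith⁺ _∷_ ∷-injective (Unique.upTo⁺ (suc n)) (boundedLists-unique k n)
  where
  nonempty : ∀ {ps} → ps ∈ cartesianProductWith _∷_ (upTo (suc n)) (boundedLists k n) → [] ≢ ps
  nonempty ps∈ refl
    with ∈-cartesianProductWith⁻ _∷_ (upTo (suc n)) (boundedLists k n) ps∈
  ... | _ , _ , _ , _ , ()

length≤sum : ∀ {ps} → All (0 <_) ps → length ps ≤ sum ps
length≤sum []       = z≤n
length≤sum (p ∷ ps) = +-mono-≤ p (length≤sum ps)

parts≤sum : ∀ ps → All (_≤ sum ps) ps
parts≤sum []       = []
parts≤sum (p ∷ ps) =
  m≤m+n p (sum ps) ∷ All.map (λ q≤ → ≤-trans q≤ (m≤n+m (sum ps) p)) (parts≤sum ps)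

partition∈boundedLists : ∀ {n ps} → IsPartition ps → sum ps ≤ n → ps ∈ boundedLists n n
partition∈boundedLists {ps = ps} (pos , _) s≤n =
  ∈-boundedLists (≤-trans (length≤sum pos) s≤n)
                 (All.map (λ p≤ → ≤-trans p≤ s≤n) (parts≤sum ps))

∈-regularBipartitions : ∀ l m n {pq} →
  pq ∈ regularBipartitions l m n ⇔ IsRegularBipartition l m n pq
∈-regularBipartitions l m n {ps , qs} = mk⇔
  (λ pq∈ → proj₂ (∈-filter⁻ (isRegularBipartition? l m n) {xs = candidates} pq∈))
  complete
  where
  candidates : List (List ℕ × List ℕ)
  candidates = cartesianProduct (boundedLists n n) (boundedLists n n)

  complete : IsRegularBipartition l m n (ps , qs) → (ps , qs) ∈ regularBipartitions l m n
  complete h@((partP , _) , (partQ , _) , eq) =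
    ∈-filter⁺ (isRegularBipartition? l m n)
      (∈-cartesianProduct⁺
        (partition∈boundedLists partP (≤-trans (m≤m+n (sum ps) (sum qs)) (≤-reflexive eq)))
        (partition∈boundedLists partQ (≤-trans (m≤n+m (sum qs) (sum ps)) (≤-reflexive eq))))
      h

regularBipartitions-unique : ∀ l m n → Unique (regularBipartitions l m n)
regularBipartitions-unique l m n =
  Unique.filter⁺ (isRegularBipartition? l m n)
    (Unique.cartesianProduct⁺ (boundedLists-unique n n) (boundedLists-unique n n))

{-# OPTIONS --safe #-}

-- Write f_k = ∏ (1 - q^(jk)), φ(q) = Σ q^(n²) over all integers n, and ψ(q) = Σ q^(n(n+1)/2) over n ≥ 0.
-- Gauss's identities φ(-q) = f₁²/f₂ and ψ(q) = f₂²/f₁, obtained from finite identities of Shanks,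
-- turn the generating function f₂f₈/f₁² into f₈/φ(-q). The relations φ(q)φ(-q) = φ(-q²)²,
-- φ(q) = φ(q⁴) + 2qψ(q⁸), φ(q)² = φ(q²)² + 4qψ(q⁴)² and ψ(q)² = φ(q)ψ(q²) allow the odd-indexed
-- coefficients to be extracted three times, which gives
--   Σ B(8n + 7) qⁿ = 64 f₁ψ(q)⁷/φ(-q)⁸ = 64 (f₂/f₁)²².
-- Modulo 11 the right-hand side is a power series in q¹¹.

module Submission where

open import Defs
open import Algebra.Bundles using (CommutativeRing)
import Algebra.Properties.AbelianGroup
import Algebra.Properties.CommutativeSemigroup
import Algebra.Properties.CommutativeSemiring.Exp
import Algebra.Properties.Ring
import Algebra.Properties.Semiring.Exp
import Algebra.Solver.Ring
open import Algebra.Solver.Ring.AlmostCommutativeRing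
  using (fromCommutativeRing; Induced-equivalence; _-Raw-AlmostCommutative⟶_)
open import Data.Empty using (⊥-elim)
open import Data.Integer.Base as ℤ using (ℤ; +_)
import Data.Integer.Divisibility.Signed as ℤ∣
import Data.Integer.Properties as ℤ
open import Data.Integer.Tactic.RingSolver using (solve-∀)
open import Data.List.Base using (List; []; _∷_; _++_; map; length; filter; cartesianProduct)
open import Data.List.Membership.Propositional using (_∈_)
open import Data.List.Membership.Propositional.Properties
  using (∈-filter⁺; ∈-filter⁻; ∈-++⁺ˡ; ∈-++⁺ʳ; ∈-++⁻; ∈-map⁺; ∈-map⁻; ∈-cartesianProduct⁺; ∈-cartesianProduct⁻)
open import Data.List.Membership.Propositional.Properties.WithK using (unique∧set⇒bag)
open import Data.List.Properties using (length-++; length-map; ∷-injectiveʳ)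
open import Data.List.Relation.Binary.BagAndSetEquality using (∼bag⇒↭)
open import Data.List.Relation.Binary.Permutation.Propositional.Properties using (↭-length)
open import Data.List.Relation.Unary.All as All using (All; []; _∷_; all?)
open import Data.List.Relation.Unary.AllPairs as AllPairs using ([]; _∷_)
open import Data.List.Relation.Unary.Linked using (Linked; []; [-]; _∷_)
open import Data.List.Relation.Unary.Linked.Properties using (Linked⇒AllPairs)
open import Data.List.Relation.Unary.Unique.Propositional using (Unique)
import Data.List.Relation.Unary.Unique.Propositional.Properties as Unique
open import Data.Maybe.Base using (just; nothing)
open import Data.Nat.Base as ℕ using (ℕ; zero; suc; _≤_; _<_; _≥_; z≤n; s≤s)
open import Data.Nat.Divisibility using (_∣_; _∣?_; >⇒∤; ∣m+n∣m⇒∣n; n∣m*n)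
open import Data.Nat.ListAction using (sum)
import Data.Nat.Properties as ℕ
import Data.Nat.Tactic.RingSolver as ℕ-RingSolver
open import Data.Product.Base using (∃; ∃₂; _×_; _,_; proj₁; proj₂)
open import Data.Sum.Base using (inj₁; inj₂)
open import Function.Base using (_∘_)
open import Function.Bundles using (_⇔_; mk⇔; Equivalence)
open import Function.Construct.Composition using (_⇔-∘_)
open import Function.Construct.Symmetry using (⇔-sym)
open import Level using (Level; 0ℓ)
open import Relation.Binary.Definitions using (WeaklyDecidable)
open import Relation.Binary.PropositionalEquality as ≡ using (_≡_)
import Relation.Binary.Reasoning.Setoid
open import Relation.Binary.Structures using (IsEquivalence)
open import Relation.Nullary.Decidable using (yes; no; _×-dec_)
open import Relation.Nullary.Negation using (¬_; contradiction)
open import Relation.Unary using (Decidable)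

-- The exponent 22 is what makes 11 work: f₂/f₁ is the reciprocal of (q; q²)_∞, and Frobenius modulo
-- 11 turns the 22nd power of that product into its square at q^11. So the generating function times
-- a series in q^11 is the constant 64, which has no coefficient in a nonzero class modulo 11. No
-- series is ever inverted. Quotients are kept as products, and factors with constant term 1 are
-- cancelled afterwards. In particular a power of φ(-q) stays multiplied onto each extracted series;
-- φ(q)φ(-q) = φ(-q²)² doubles that power at every extraction, which accounts for the 8th power.
-- Infinite sums and products are coefficientwise limits. This is why finite identities with an
-- explicit error term are the convenient source of Gauss's identities: induction proves them, and
-- the error disappears in the limit. The coefficients lie in an arbitrary commutative ring `K` with
-- a homomorphism from ℤ. It is finally taken to be ℤ with congruence modulo 11 as equality, but the
-- vanishing of 11 enters only with Frobenius.

private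
  module ℕ+ = Algebra.Properties.CommutativeSemigroup ℕ.+-commutativeSemigroup

-- The ring of formal power series over a commutative ring

module PowerSeries {c ℓ : Level} (K : CommutativeRing c ℓ) where

  private
    module K where
      open CommutativeRing K public
      open Algebra.Properties.CommutativeSemigroup +-commutativeSemigroup public
        using (x∙yz≈y∙xz; x∙yz≈xy∙z)
        renaming (interchange to +-interchange)
      open Algebra.Properties.Ring ring public
        using (-‿distribʳ-*; -0#≈0#; -‿involutive)
      open Algebra.Properties.AbelianGroup +-abelianGroup public
        using (⁻¹-∙-comm)
      open import Relation.Binary.Reasoning.Setoid setoid public

  Series : Set c
  Series = ℕ → K.Carrier

  infix  4 _≋_
  infixl 6 _⊕_
  infixl 7 _⊛_ _·_
  infix  8 ⊖_

  -- A record rather than a synonym for the pointwise relation, so that A and B can be inferred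
  -- from A ≋ B.
  record _≋_ (A B : Series) : Set ℓ where
    field at : ∀ n → A n K.≈ B n

  open _≋_ public

  constant : K.Carrier → Series
  constant k zero    = k
  constant k (suc _) = K.0#

  0ₛ 1ₛ q : Series
  0ₛ _ = K.0#
  1ₛ = constant K.1#
  q zero    = K.0#
  q (suc n) = 1ₛ n

  tail : Series → Series
  tail A n = A (suc n)

  -- The Cauchy product is defined by peeling off the constant term, A = A 0 + q · `tail` A. The
  -- ring laws then follow by induction on the index of the coefficient, without finite sums.
  _⊕_ _⊛_ : Series → Series → Series
  (A ⊕ B) n = A n K.+ B n
  (A ⊛ B) zero    = A 0 K.* B 0
  (A ⊛ B) (suc n) = A 0 K.* B (suc n) K.+ (tail A ⊛ B) n

  _·_ : K.Carrier → Series → Series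
  (k · A) n = k K.* A n

  ⊖_ : Series → Series
  (⊖ A) n = K.- A n

  tail-cong : ∀ {A B} → A ≋ B → tail A ≋ tail B
  tail-cong A≋B .at n = A≋B .at (suc n)

  -- Coefficient n of a product sees only the coefficients up to n of its factors. Congruence is a
  -- special case; the bounded form is what lets products pass to limits.
  ⊛-cong-≤ : ∀ n {A A′ B B′} → (∀ {i} → i ≤ n → A i K.≈ A′ i) → (∀ {i} → i ≤ n → B i K.≈ B′ i) →
             (A ⊛ B) n K.≈ (A′ ⊛ B′) n
  ⊛-cong-≤ zero    A≈ B≈ = K.*-cong (A≈ z≤n) (B≈ z≤n)
  ⊛-cong-≤ (suc n) A≈ B≈ =
    K.+-cong (K.*-cong (A≈ z≤n) (B≈ ℕ.≤-refl))
             (⊛-cong-≤ n (λ i≤n → A≈ (s≤s i≤n)) (λ i≤n → B≈ (ℕ.m≤n⇒m≤1+n i≤n)))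

  ⊛-cong : ∀ {A A′ B B′} → A ≋ A′ → B ≋ B′ → A ⊛ B ≋ A′ ⊛ B′
  ⊛-cong A≈ B≈ .at n = ⊛-cong-≤ n (λ {i} _ → A≈ .at i) (λ {i} _ → B≈ .at i)

  ⊛-zeroˡ : ∀ A → 0ₛ ⊛ A ≋ 0ₛ
  ⊛-zeroˡ A .at zero    = K.zeroˡ (A 0)
  ⊛-zeroˡ A .at (suc n) = K.trans (K.+-cong (K.zeroˡ _) (⊛-zeroˡ A .at n)) (K.+-identityˡ _)

  ⊛-identityˡ : ∀ A → 1ₛ ⊛ A ≋ A
  ⊛-identityˡ A .at zero    = K.*-identityˡ _
  ⊛-identityˡ A .at (suc n) = K.trans (K.+-cong (K.*-identityˡ _) (⊛-zeroˡ A .at n)) (K.+-identityʳ _)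

  ⊛-distribʳ : ∀ C A B → (A ⊕ B) ⊛ C ≋ A ⊛ C ⊕ B ⊛ C
  ⊛-distribʳ C A B .at zero    = K.distribʳ _ _ _
  ⊛-distribʳ C A B .at (suc n) =
    K.trans (K.+-cong (K.distribʳ _ _ _) (⊛-distribʳ C (tail A) (tail B) .at n)) (K.+-interchange _ _ _ _)

  ·-⊛ : ∀ k A B → (k · A) ⊛ B ≋ k · (A ⊛ B)
  ·-⊛ k A B .at zero    = K.*-assoc _ _ _
  ·-⊛ k A B .at (suc n) =
    K.trans (K.+-cong (K.*-assoc _ _ _) (·-⊛ k (tail A) B .at n)) (K.sym (K.distribˡ _ _ _))

  ⊛-assoc : ∀ A B C → (A ⊛ B) ⊛ C ≋ A ⊛ (B ⊛ C)
  ⊛-assoc A B C .at zero    = K.*-assoc _ _ _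
  ⊛-assoc A B C .at (suc n) = begin
    A 0 * B 0 * C (suc n) + ((A 0 · tail B ⊕ tail A ⊛ B) ⊛ C) n
      ≈⟨ +-cong (*-assoc _ _ _) (⊛-distribʳ C (A 0 · tail B) (tail A ⊛ B) .at n) ⟩
    A 0 * (B 0 * C (suc n)) + (((A 0 · tail B) ⊛ C) n + ((tail A ⊛ B) ⊛ C) n)
      ≈⟨ +-congˡ (+-cong (·-⊛ (A 0) (tail B) C .at n) (⊛-assoc (tail A) B C .at n)) ⟩
    A 0 * (B 0 * C (suc n)) + (A 0 * (tail B ⊛ C) n + (tail A ⊛ (B ⊛ C)) n)
      ≈⟨ x∙yz≈xy∙z _ _ _ ⟩
    A 0 * (B 0 * C (suc n)) + A 0 * (tail B ⊛ C) n + (tail A ⊛ (B ⊛ C)) n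
      ≈⟨ +-congʳ (distribˡ _ _ _) ⟨
    A 0 * (B 0 * C (suc n) + (tail B ⊛ C) n) + (tail A ⊛ (B ⊛ C)) n ∎
    where open K

  ⊛-tailʳ : ∀ A B n → (A ⊛ B) (suc n) K.≈ A (suc n) K.* B 0 K.+ (A ⊛ tail B) n
  ⊛-tailʳ A B zero    = K.+-comm _ _
  ⊛-tailʳ A B (suc n) = K.trans (K.+-congˡ (⊛-tailʳ (tail A) B n)) (K.x∙yz≈y∙xz _ _ _)

  ⊛-comm : ∀ A B → A ⊛ B ≋ B ⊛ A
  ⊛-comm A B .at zero    = K.*-comm _ _
  ⊛-comm A B .at (suc n) =
    K.trans (K.+-cong (K.*-comm _ _) (⊛-comm (tail A) B .at n)) (K.sym (⊛-tailʳ B A n))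

  ⊛-identityʳ : ∀ A → A ⊛ 1ₛ ≋ A
  ⊛-identityʳ A .at n = K.trans (⊛-comm A 1ₛ .at n) (⊛-identityˡ A .at n)

  ⊛-distribˡ : ∀ C A B → C ⊛ (A ⊕ B) ≋ C ⊛ A ⊕ C ⊛ B
  ⊛-distribˡ C A B .at n = K.trans (⊛-comm C (A ⊕ B) .at n)
    (K.trans (⊛-distribʳ C A B .at n) (K.+-cong (⊛-comm A C .at n) (⊛-comm B C .at n)))

  ≋-isEquivalence : IsEquivalence _≋_
  ≋-isEquivalence .IsEquivalence.refl .at _ = K.refl
  ≋-isEquivalence .IsEquivalence.sym A≋B .at n = K.sym (A≋B .at n)
  ≋-isEquivalence .IsEquivalence.trans A≋B B≋C .at n = K.trans (A≋B .at n) (B≋C .at n)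

  ⊕-cong : ∀ {A A′ B B′} → A ≋ A′ → B ≋ B′ → A ⊕ B ≋ A′ ⊕ B′
  ⊕-cong A≋A′ B≋B′ .at n = K.+-cong (A≋A′ .at n) (B≋B′ .at n)

  ⊕-assoc : ∀ A B C → (A ⊕ B) ⊕ C ≋ A ⊕ (B ⊕ C)
  ⊕-assoc A B C .at n = K.+-assoc (A n) (B n) (C n)

  ⊕-identityˡ : ∀ A → 0ₛ ⊕ A ≋ A
  ⊕-identityˡ A .at n = K.+-identityˡ (A n)

  ⊕-identityʳ : ∀ A → A ⊕ 0ₛ ≋ A
  ⊕-identityʳ A .at n = K.+-identityʳ (A n)

  ⊖-inverseˡ : ∀ A → ⊖ A ⊕ A ≋ 0ₛ
  ⊖-inverseˡ A .at n = K.-‿inverseˡ (A n)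

  ⊖-inverseʳ : ∀ A → A ⊕ ⊖ A ≋ 0ₛ
  ⊖-inverseʳ A .at n = K.-‿inverseʳ (A n)

  ⊖-cong : ∀ {A B} → A ≋ B → ⊖ A ≋ ⊖ B
  ⊖-cong A≋B .at n = K.-‿cong (A≋B .at n)

  ⊕-comm : ∀ A B → A ⊕ B ≋ B ⊕ A
  ⊕-comm A B .at n = K.+-comm (A n) (B n)

  commutativeRing : CommutativeRing c ℓ
  commutativeRing = record
    { Carrier = Series
    ; _≈_ = _≋_
    ; _+_ = _⊕_
    ; _*_ = _⊛_
    ; -_ = ⊖_
    ; 0# = 0ₛ
    ; 1# = 1ₛ
    ; isCommutativeRing = record
      { isRing = record
        { +-isAbelianGroup = record
          { isGroup = record
            { isMonoid = record
              { isSemigroup = record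
                { isMagma = record { isEquivalence = ≋-isEquivalence ; ∙-cong = ⊕-cong }
                ; assoc = ⊕-assoc
                }
              ; identity = ⊕-identityˡ , ⊕-identityʳ
              }
            ; inverse = ⊖-inverseˡ , ⊖-inverseʳ
            ; ⁻¹-cong = ⊖-cong
            }
          ; comm = ⊕-comm
          }
        ; *-cong = ⊛-cong
        ; *-assoc = ⊛-assoc
        ; *-identity = ⊛-identityˡ , ⊛-identityʳ
        ; distrib = ⊛-distribˡ , ⊛-distribʳ
        }
      ; *-comm = ⊛-comm
      }
    }

  constant-⊕ : ∀ k l → constant (k K.+ l) ≋ constant k ⊕ constant l
  constant-⊕ k l .at zero    = K.refl
  constant-⊕ k l .at (suc n) = K.sym (K.+-identityˡ _)

  constant-⊛ : ∀ k l → constant (k K.* l) ≋ constant k ⊛ constant l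
  constant-⊛ k l .at zero    = K.refl
  constant-⊛ k l .at (suc n) =
    K.sym (K.trans (K.+-cong (K.zeroʳ k) (⊛-zeroˡ (constant l) .at n)) (K.+-identityˡ _))

  constant-⊖ : ∀ k → constant (K.- k) ≋ ⊖ constant k
  constant-⊖ k .at zero    = K.refl
  constant-⊖ k .at (suc n) = K.sym K.-0#≈0#

  constant-0 : constant K.0# ≋ 0ₛ
  constant-0 .at zero    = K.refl
  constant-0 .at (suc n) = K.refl

  private
    module S where
      open CommutativeRing commutativeRing public
      open Algebra.Properties.Ring ring public using (-‿distribˡ-*)
      open Algebra.Properties.AbelianGroup +-abelianGroup public using (x∙y⁻¹≈ε⇒x≈y)
      open Relation.Binary.Reasoning.Setoid setoid public

  open Algebra.Properties.Semiring.Exp S.semiring using (_^_)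

  -- Since A has constant term 1, the constant term of B must vanish; then `tail` B satisfies the
  -- same hypothesis. This replaces division and is valid even if `K` has zero divisors.
  ⊛-cancelʳ-0 : ∀ {A B} → A 0 K.≈ K.1# → B ⊛ A ≋ 0ₛ → B ≋ 0ₛ
  ⊛-cancelʳ-0 {A} {B} A₀≈1 BA≋0 .at zero = begin
    B 0          ≈⟨ *-identityʳ _ ⟨
    B 0 * 1#     ≈⟨ *-congˡ A₀≈1 ⟨
    B 0 * A 0    ≈⟨ BA≋0 .at 0 ⟩
    0#           ∎
    where open K
  ⊛-cancelʳ-0 {A} {B} A₀≈1 BA≋0 .at (suc n) = ⊛-cancelʳ-0 {A} {tail B} A₀≈1 tail≋0 .at n
    where
    open K
    tail≋0 : tail B ⊛ A ≋ 0ₛ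
    tail≋0 .at m = begin
      (tail B ⊛ A) m                        ≈⟨ +-identityˡ _ ⟨
      0# + (tail B ⊛ A) m                   ≈⟨ +-congʳ (zeroˡ _) ⟨
      0# * A (suc m) + (tail B ⊛ A) m       ≈⟨ +-congʳ (*-congʳ (⊛-cancelʳ-0 {A} {B} A₀≈1 BA≋0 .at 0)) ⟨
      B 0 * A (suc m) + (tail B ⊛ A) m      ≈⟨ BA≋0 .at (suc m) ⟩
      0#                                    ∎

  ⊛-cancelʳ : ∀ {A B C} → A 0 K.≈ K.1# → B ⊛ A ≋ C ⊛ A → B ≋ C
  ⊛-cancelʳ {A} {B} {C} A₀≈1 BA≋CA = S.x∙y⁻¹≈ε⇒x≈y B C (⊛-cancelʳ-0 A₀≈1 (begin
    (B ⊕ ⊖ C) ⊛ A         ≈⟨ distribʳ A B (⊖ C) ⟩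
    B ⊛ A ⊕ (⊖ C) ⊛ A     ≈⟨ +-cong BA≋CA (sym (S.-‿distribˡ-* C A)) ⟩
    C ⊛ A ⊕ ⊖ (C ⊛ A)     ≈⟨ -‿inverseʳ (C ⊛ A) ⟩
    0ₛ                    ∎))
    where open S

  -- Coefficient extraction and substitutions

  q-⊛-suc : ∀ A n → (q ⊛ A) (suc n) K.≈ A n
  q-⊛-suc A n = K.trans (K.+-cong (K.zeroˡ _) (⊛-identityˡ A .at n)) (K.+-identityˡ _)

  q^-⊛-< : ∀ k A {n} → n < k → (q ^ k ⊛ A) n K.≈ K.0#
  q^-⊛-< (suc k) A {zero}  _         =
    K.trans (⊛-assoc q (q ^ k) A .at 0) (K.zeroˡ _)
  q^-⊛-< (suc k) A {suc n} (s≤s n<k) =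
    K.trans (⊛-assoc q (q ^ k) A .at (suc n)) (K.trans (q-⊛-suc (q ^ k ⊛ A) n) (q^-⊛-< k A n<k))

  q^-⊛-+ : ∀ k A n → (q ^ k ⊛ A) (k ℕ.+ n) K.≈ A n
  q^-⊛-+ zero    A n = ⊛-identityˡ A .at n
  q^-⊛-+ (suc k) A n =
    K.trans (⊛-assoc q (q ^ k) A .at (suc (k ℕ.+ n)))
            (K.trans (q-⊛-suc (q ^ k ⊛ A) (k ℕ.+ n)) (q^-⊛-+ k A n))

  -- spread e c A = q ^ c · A(q ^ (e + 1)).
  spread : ℕ → ℕ → Series → Series
  spread e zero    A zero    = A 0
  spread e zero    A (suc n) = spread e e (tail A) n
  spread e (suc c) A zero    = K.0#
  spread e (suc c) A (suc n) = spread e c A n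

  section : ℕ → ℕ → Series → Series
  section d r A n = A (r ℕ.+ n ℕ.* d)

  -- The substitution A(-q): every step into the tail flips the sign of all that follows.
  negate : Series → Series
  negate A zero    = A 0
  negate A (suc n) = K.- negate (tail A) n

  module _ (e : ℕ) where

    spread-cong : ∀ c {A B} → A ≋ B → spread e c A ≋ spread e c B
    spread-cong zero    A≋B .at zero    = A≋B .at 0
    spread-cong zero    A≋B .at (suc n) = spread-cong e (tail-cong A≋B) .at n
    spread-cong (suc c) A≋B .at zero    = K.refl
    spread-cong (suc c) A≋B .at (suc n) = spread-cong c A≋B .at n

    spread-⊕ : ∀ c A B → spread e c (A ⊕ B) ≋ spread e c A ⊕ spread e c B
    spread-⊕ zero    A B .at zero    = K.refl
    spread-⊕ zero    A B .at (suc n) = spread-⊕ e (tail A) (tail B) .at n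
    spread-⊕ (suc c) A B .at zero    = K.sym (K.+-identityˡ _)
    spread-⊕ (suc c) A B .at (suc n) = spread-⊕ c A B .at n

    spread-⊖ : ∀ c A → spread e c (⊖ A) ≋ ⊖ spread e c A
    spread-⊖ zero    A .at zero    = K.refl
    spread-⊖ zero    A .at (suc n) = spread-⊖ e (tail A) .at n
    spread-⊖ (suc c) A .at zero    = K.sym K.-0#≈0#
    spread-⊖ (suc c) A .at (suc n) = spread-⊖ c A .at n

    spread-· : ∀ c k A → spread e c (k · A) ≋ k · spread e c A
    spread-· zero    k A .at zero    = K.refl
    spread-· zero    k A .at (suc n) = spread-· e k (tail A) .at n
    spread-· (suc c) k A .at zero    = K.sym (K.zeroʳ _)
    spread-· (suc c) k A .at (suc n) = spread-· c k A .at n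

    spread-0ₛ : ∀ c → spread e c 0ₛ ≋ 0ₛ
    spread-0ₛ zero    .at zero    = K.refl
    spread-0ₛ zero    .at (suc n) = spread-0ₛ e .at n
    spread-0ₛ (suc c) .at zero    = K.refl
    spread-0ₛ (suc c) .at (suc n) = spread-0ₛ c .at n

    spread-constant : ∀ k → spread e 0 (constant k) ≋ constant k
    spread-constant k .at zero    = K.refl
    spread-constant k .at (suc n) = spread-0ₛ e .at n

    -- The offset c has to be general because the recursion of the product meets the tail of a
    -- spread series, which begins in the middle of a gap.
    spread-⊛ : ∀ c A B → spread e c A ⊛ spread e 0 B ≋ spread e c (A ⊛ B)
    spread-⊛ zero    A B .at zero    = K.refl
    spread-⊛ zero    A B .at (suc n) = begin
      A 0 * spread e e (tail B) n + (spread e e (tail A) ⊛ spread e 0 B) n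
        ≈⟨ +-cong (sym (spread-· e (A 0) (tail B) .at n)) (spread-⊛ e (tail A) B .at n) ⟩
      spread e e (A 0 · tail B) n + spread e e (tail A ⊛ B) n
        ≈⟨ spread-⊕ e (A 0 · tail B) (tail A ⊛ B) .at n ⟨
      spread e e (tail (A ⊛ B)) n ∎
      where open K
    spread-⊛ (suc c) A B .at zero    = K.zeroˡ _
    spread-⊛ (suc c) A B .at (suc n) =
      K.trans (K.+-cong (K.zeroˡ _) (spread-⊛ c A B .at n)) (K.+-identityˡ _)

    spread-q^ : ∀ c → spread e c 1ₛ ≋ q ^ c
    spread-q^ zero    .at n       = spread-constant K.1# .at n
    spread-q^ (suc c) .at zero    = K.sym (K.zeroˡ _)
    spread-q^ (suc c) .at (suc n) = K.trans (spread-q^ c .at n) (K.sym (q-⊛-suc (q ^ c) n))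

    spread-q : spread e 0 q ≋ q ^ suc e
    spread-q .at zero    = K.sym (K.zeroˡ _)
    spread-q .at (suc n) = K.trans (spread-q^ e .at n) (K.sym (q-⊛-suc (q ^ e) n))

    spread-⊛-< : ∀ c A B {n} → n < c → (spread e c B ⊛ A) n K.≈ K.0#
    spread-⊛-< (suc c) A B {zero}  _         = K.zeroˡ _
    spread-⊛-< (suc c) A B {suc n} (s≤s n<c) =
      K.trans (K.+-cong (K.zeroˡ _) (spread-⊛-< c A B n<c)) (K.+-identityˡ _)

    spread-⊛-+ : ∀ c A B n → (spread e c B ⊛ A) (c ℕ.+ n) K.≈ (spread e 0 B ⊛ A) n
    spread-⊛-+ zero    A B n = K.refl
    spread-⊛-+ (suc c) A B n =
      K.trans (K.+-cong (K.zeroˡ _) (spread-⊛-+ c A B n)) (K.+-identityˡ _)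

    private
      section-index : ∀ r n → r ℕ.+ suc (e ℕ.+ n ℕ.* suc e) ≡ suc (e ℕ.+ (r ℕ.+ n ℕ.* suc e))
      section-index r n = ≡.trans (ℕ.+-suc r _) (≡.cong suc (ℕ+.x∙yz≈y∙xz r e (n ℕ.* suc e)))

    -- A factor in q^(e + 1) does not mix the residue classes modulo e + 1, so it leaves the section
    -- with its gaps removed. All coefficient extractions below rest on this.
    section-spread-⊛ : ∀ {r} → r ≤ e → ∀ A B →
                       section (suc e) r (spread e 0 B ⊛ A) ≋ B ⊛ section (suc e) r A
    section-spread-⊛ {zero}  _   A B .at zero = K.refl
    section-spread-⊛ {suc r} r<e A B .at zero =
      K.trans (K.+-congˡ (spread-⊛-< e A (tail B) (ℕ.≤-trans (s≤s (ℕ.≤-reflexive (ℕ.+-identityʳ r))) r<e)))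
              (K.+-identityʳ _)
    section-spread-⊛ {r} r≤e A B .at (suc n) rewrite section-index r n =
      K.+-congˡ (K.trans (spread-⊛-+ e A (tail B) _) (section-spread-⊛ r≤e A (tail B) .at n))

  negate-cong : ∀ {A B} → A ≋ B → negate A ≋ negate B
  negate-cong A≋B .at zero    = A≋B .at 0
  negate-cong A≋B .at (suc n) = K.-‿cong (negate-cong (tail-cong A≋B) .at n)

  negate-⊕ : ∀ A B → negate (A ⊕ B) ≋ negate A ⊕ negate B
  negate-⊕ A B .at zero    = K.refl
  negate-⊕ A B .at (suc n) =
    K.trans (K.-‿cong (negate-⊕ (tail A) (tail B) .at n)) (K.sym (K.⁻¹-∙-comm _ _))

  negate-⊖ : ∀ A → negate (⊖ A) ≋ ⊖ negate A
  negate-⊖ A .at zero    = K.refl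
  negate-⊖ A .at (suc n) = K.-‿cong (negate-⊖ (tail A) .at n)

  negate-· : ∀ k A → negate (k · A) ≋ k · negate A
  negate-· k A .at zero    = K.refl
  negate-· k A .at (suc n) = K.trans (K.-‿cong (negate-· k (tail A) .at n)) (K.-‿distribʳ-* _ _)

  negate-0ₛ : negate 0ₛ ≋ 0ₛ
  negate-0ₛ .at zero    = K.refl
  negate-0ₛ .at (suc n) = K.trans (K.-‿cong (negate-0ₛ .at n)) K.-0#≈0#

  negate-constant : ∀ k → negate (constant k) ≋ constant k
  negate-constant k .at zero    = K.refl
  negate-constant k .at (suc n) = K.trans (K.-‿cong (negate-0ₛ .at n)) K.-0#≈0#

  negate-q : negate q ≋ ⊖ q
  negate-q .at zero    = K.sym K.-0#≈0#
  negate-q .at (suc n) = K.-‿cong (negate-constant K.1# .at n)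

  negate-⊛ : ∀ A B → negate (A ⊛ B) ≋ negate A ⊛ negate B
  negate-⊛ A B .at zero    = K.refl
  negate-⊛ A B .at (suc n) = begin
    - negate (A 0 · tail B ⊕ tail A ⊛ B) n
      ≈⟨ -‿cong (negate-⊕ (A 0 · tail B) (tail A ⊛ B) .at n) ⟩
    - (negate (A 0 · tail B) n + negate (tail A ⊛ B) n)
      ≈⟨ -‿cong (+-cong (negate-· (A 0) (tail B) .at n) (negate-⊛ (tail A) B .at n)) ⟩
    - (A 0 * negate (tail B) n + (negate (tail A) ⊛ negate B) n)
      ≈⟨ ⁻¹-∙-comm _ _ ⟨
    - (A 0 * negate (tail B) n) + - (negate (tail A) ⊛ negate B) n
      ≈⟨ +-cong (-‿distribʳ-* _ _) (S.-‿distribˡ-* (negate (tail A)) (negate B) .at n) ⟩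
    A 0 * - negate (tail B) n + (tail (negate A) ⊛ negate B) n ∎
    where open K

  negate-spread : ∀ A → negate (spread 1 0 A) ≋ spread 1 0 A
  negate-spread A .at zero          = K.refl
  negate-spread A .at (suc zero)    = K.-0#≈0#
  negate-spread A .at (suc (suc n)) = K.trans (K.-‿involutive _) (negate-spread (tail A) .at n)

  -- Limits and infinite products

  infix 4 _⟶_

  -- Convergence at a fixed rate: term m is already correct up to degree m. All sequences used here
  -- attain this rate, if necessary along a subsequence, so no thresholds need to be carried along.
  _⟶_ : (ℕ → Series) → Series → Set ℓ
  a ⟶ A = ∀ {m i} → i ≤ m → a m i K.≈ A i

  ⟶-unique : ∀ {a A B} → a ⟶ A → a ⟶ B → A ≋ B
  ⟶-unique a⟶A a⟶B .at n = K.trans (K.sym (a⟶A (ℕ.≤-refl {n}))) (a⟶B ℕ.≤-refl)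

  ⟶-diagonal : ∀ {a} → (∀ {m i} → i ≤ m → a (suc m) i K.≈ a m i) → a ⟶ (λ n → a n n)
  ⟶-diagonal {a} step {m} {i} i≤m = stable (ℕ.≤⇒≤′ i≤m)
    where
    stable : ∀ {m} → i ℕ.≤′ m → a m i K.≈ a i i
    stable (ℕ.≤′-reflexive ≡.refl) = K.refl
    stable (ℕ.≤′-step i≤′m) = K.trans (step (ℕ.≤′⇒≤ i≤′m)) (stable i≤′m)

  ⟶-cong : ∀ {a b A} → (∀ m → a m ≋ b m) → a ⟶ A → b ⟶ A
  ⟶-cong a≋b a⟶A {m} {i} i≤m = K.trans (K.sym (a≋b m .at i)) (a⟶A i≤m)

  ⟶-const : ∀ A → (λ _ → A) ⟶ A
  ⟶-const A _ = K.refl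

  ⟶-subsequence : ∀ {a A} (g : ℕ → ℕ) → (∀ m → m ≤ g m) → a ⟶ A → (λ m → a (g m)) ⟶ A
  ⟶-subsequence g m≤gm a⟶A {m} i≤m = a⟶A (ℕ.≤-trans i≤m (m≤gm m))

  ⟶-⊕ : ∀ {a b A B} → a ⟶ A → b ⟶ B → (λ m → a m ⊕ b m) ⟶ A ⊕ B
  ⟶-⊕ a⟶A b⟶B i≤m = K.+-cong (a⟶A i≤m) (b⟶B i≤m)

  ⟶-⊖ : ∀ {a A} → a ⟶ A → (λ m → ⊖ a m) ⟶ ⊖ A
  ⟶-⊖ a⟶A i≤m = K.-‿cong (a⟶A i≤m)

  ⟶-⊛ : ∀ {a b A B} → a ⟶ A → b ⟶ B → (λ m → a m ⊛ b m) ⟶ A ⊛ B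
  ⟶-⊛ a⟶A b⟶B {i = i} i≤m =
    ⊛-cong-≤ i (λ j≤i → a⟶A (ℕ.≤-trans j≤i i≤m)) (λ j≤i → b⟶B (ℕ.≤-trans j≤i i≤m))

  ⟶-spread : ∀ e {a A} → a ⟶ A → (λ m → spread e 0 (a m)) ⟶ spread e 0 A
  ⟶-spread e a⟶A {m} {i} i≤m = agree 0 i (λ j≤i → a⟶A (ℕ.≤-trans j≤i i≤m))
    where
    agree : ∀ c i {A B} → (∀ {j} → j ≤ i → A j K.≈ B j) → spread e c A i K.≈ spread e c B i
    agree zero    zero    A≈B = A≈B z≤n
    agree zero    (suc i) A≈B = agree e i (λ j≤i → A≈B (s≤s j≤i))
    agree (suc c) zero    A≈B = K.refl
    agree (suc c) (suc i) A≈B = agree c i (λ j≤i → A≈B (ℕ.m≤n⇒m≤1+n j≤i))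

  ⟶-negate : ∀ {a A} → a ⟶ A → (λ m → negate (a m)) ⟶ negate A
  ⟶-negate a⟶A {m} {i} i≤m = agree i (λ j≤i → a⟶A (ℕ.≤-trans j≤i i≤m))
    where
    agree : ∀ i {A B} → (∀ {j} → j ≤ i → A j K.≈ B j) → negate A i K.≈ negate B i
    agree zero    A≈B = A≈B z≤n
    agree (suc i) A≈B = K.-‿cong (agree i (λ j≤i → A≈B (s≤s j≤i)))

  ∏< : ℕ → (ℕ → Series) → Series
  ∏< zero    u = 1ₛ
  ∏< (suc n) u = ∏< n u ⊛ u n

  -- The diagonal of the partial products; it is their limit when the factors are `Convergent`.
  ∏ : (ℕ → Series) → Series
  ∏ u n = ∏< n u n

  -- Factor j is 1 modulo q^(j + 1), so appending it leaves the coefficients up to degree j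
  -- untouched.
  Convergent : (ℕ → Series) → Set ℓ
  Convergent u = ∀ {j i} → i ≤ j → u j i K.≈ 1ₛ i

  ∏<⟶∏ : ∀ {u} → Convergent u → (λ m → ∏< m u) ⟶ ∏ u
  ∏<⟶∏ {u} conv = ⟶-diagonal λ {m} {i} i≤m →
    K.trans (⊛-cong-≤ i (λ _ → K.refl) (λ j≤i → conv (ℕ.≤-trans j≤i i≤m))) (⊛-identityʳ (∏< m u) .at i)

  ∏<-cong : ∀ n {u v} → (∀ j → u j ≋ v j) → ∏< n u ≋ ∏< n v
  ∏<-cong zero    u≋v = S.refl
  ∏<-cong (suc n) u≋v = ⊛-cong (∏<-cong n u≋v) (u≋v n)

  ∏<-spread : ∀ e n u → spread e 0 (∏< n u) ≋ ∏< n (λ j → spread e 0 (u j))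
  ∏<-spread e zero    u = spread-constant e K.1#
  ∏<-spread e (suc n) u =
    S.trans (S.sym (spread-⊛ e 0 (∏< n u) (u n))) (⊛-cong (∏<-spread e n u) S.refl)

-- Regular partitions

equinumerous : ∀ {a} {A : Set a} {xs ys : List A} → Unique xs → Unique ys →
               (∀ {x} → x ∈ xs ⇔ x ∈ ys) → length xs ≡ length ys
equinumerous xs! ys! xs∼ys = ↭-length (∼bag⇒↭ (unique∧set⇒bag xs! ys! xs∼ys))

-- The bound k on the parts is there for the recursion: raising it by one corresponds to one more
-- factor of the Euler product.
IsRegularPartition : (l k n : ℕ) → List ℕ → Set
IsRegularPartition l k n ps = (IsPartition ps × IsRegular l ps) × All (_≤ k) ps × sum ps ≡ n

isRegularPartition? : ∀ l k n → Decidable (IsRegularPartition l k n)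
isRegularPartition? l k n ps =
  (isPartition? ps ×-dec isRegular? l ps) ×-dec all? (ℕ._≤? k) ps ×-dec (sum ps ℕ.≟ n)

regularPartitions : (l k n : ℕ) → List (List ℕ)
regularPartitions l k n = filter (isRegularPartition? l k n) (boundedLists n n)

regularPartitions-unique : ∀ l k n → Unique (regularPartitions l k n)
regularPartitions-unique l k n = Unique.filter⁺ (isRegularPartition? l k n) (boundedLists-unique n n)

∈-regularPartitions : ∀ l k n {ps} → ps ∈ regularPartitions l k n ⇔ IsRegularPartition l k n ps
∈-regularPartitions l k n {ps} = mk⇔
  (λ ps∈ → proj₂ (∈-filter⁻ (isRegularPartition? l k n) {xs = boundedLists n n} ps∈))
  (λ h → ∈-filter⁺ (isRegularPartition? l k n)
           (partition∈boundedLists (proj₁ (proj₁ h)) (ℕ.≤-reflexive (proj₂ (proj₂ h)))) h)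

count : (l k n : ℕ) → ℕ
count l k n = length (regularPartitions l k n)

count-cong : ∀ {l k n k′ n′} → (∀ {ps} → IsRegularPartition l k n ps ⇔ IsRegularPartition l k′ n′ ps) →
             count l k n ≡ count l k′ n′
count-cong {l} {k} {n} {k′} {n′} same = equinumerous
  (regularPartitions-unique l k n) (regularPartitions-unique l k′ n′)
  (⇔-sym (∈-regularPartitions l k′ n′) ⇔-∘ (same ⇔-∘ ∈-regularPartitions l k n))

sum-bounds-parts : ∀ {n ps} → sum ps ≡ n → All (_≤ n) ps
sum-bounds-parts {ps = ps} ≡.refl = parts≤sum ps

count-stable : ∀ l {k n} → n ≤ k → count l k n ≡ count l n n
count-stable l n≤k = count-cong (mk⇔
  (λ (h , _ , eq) → h , sum-bounds-parts eq , eq)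
  (λ (h , _ , eq) → h , All.map (λ p≤n → ℕ.≤-trans p≤n n≤k) (sum-bounds-parts eq) , eq))

count-small : ∀ l {k n} → n < suc k → count l (suc k) n ≡ count l k n
count-small l (s≤s n≤k) = ≡.trans (count-stable l (ℕ.m≤n⇒m≤1+n n≤k)) (≡.sym (count-stable l n≤k))

-- A part k + 1 would be a multiple of l, so the larger bound admits nothing new.
count-divisible : ∀ l {k} n → l ∣ suc k → count l (suc k) n ≡ count l k n
count-divisible l {k} n l∣1+k = count-cong {l} {suc k} {n} {k} {n} (mk⇔
  (λ ((h , reg) , bd , eq) → (h , reg) , All.zipWith strict (reg , bd) , eq)
  (λ (h , bd , eq) → h , All.map ℕ.m≤n⇒m≤1+n bd , eq))
  where
  strict : ∀ {p} → (¬ l ∣ p) × p ≤ suc k → p ≤ k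
  strict {p} (l∤p , p≤1+k) = ℕ.≤-pred (ℕ.≤∧≢⇒< p≤1+k λ { ≡.refl → l∤p l∣1+k })

linked-cons : ∀ {p ps} → All (_≤ p) ps → Linked _≥_ ps → Linked _≥_ (p ∷ ps)
linked-cons []        []  = [-]
linked-cons (le ∷ _) lk  = le ∷ lk

linked-head : ∀ {p ps} → Linked _≥_ (p ∷ ps) → All (_≤ p) ps
linked-head = AllPairs.head ∘ Linked⇒AllPairs (λ x≥y y≥z → ℕ.≤-trans y≥z x≥y)

linked-tail : ∀ {p ps} → Linked _≥_ (p ∷ ps) → Linked _≥_ ps
linked-tail [-]      = []
linked-tail (_ ∷ lk) = lk

-- Either no part equals k + 1, or the first part does. Removing it leaves a partition of m under
-- the same bound, since k + 1 may occur again. For generating functions this reads C(k + 1) = C(k)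
-- + q^(k + 1) C(k + 1).
count-split : ∀ l {k} m → ¬ l ∣ suc k → count l (suc k) (suc k ℕ.+ m) ≡ count l k (suc k ℕ.+ m) ℕ.+ count l (suc k) m
count-split l {k} m l∤1+k = ≡.trans
  (equinumerous (regularPartitions-unique l (suc k) n)
    (Unique.++⁺ (regularPartitions-unique l k n) (Unique.map⁺ ∷-injectiveʳ (regularPartitions-unique l (suc k) m)) disjoint)
    (mk⇔ (to ∘ Equivalence.to (∈-regularPartitions l (suc k) n))
         (Equivalence.from (∈-regularPartitions l (suc k) n) ∘ from)))
  (≡.trans (length-++ (regularPartitions l k n)) (≡.cong (count l k n ℕ.+_) (length-map (suc k ∷_) (regularPartitions l (suc k) m))))
  where
  n = suc k ℕ.+ m
  withLargest : List (List ℕ)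
  withLargest = map (suc k ∷_) (regularPartitions l (suc k) m)

  disjoint : ∀ {ps} → ¬ (ps ∈ regularPartitions l k n × ps ∈ withLargest)
  disjoint (ps∈ , ps∈′) with ∈-map⁻ (suc k ∷_) ps∈′
  ... | _ , _ , ≡.refl with Equivalence.to (∈-regularPartitions l k n) ps∈
  ... | _ , (1+k≤k ∷ _) , _ = ℕ.1+n≰n 1+k≤k

  to : ∀ {ps} → IsRegularPartition l (suc k) n ps → ps ∈ regularPartitions l k n ++ withLargest
  to {p ∷ ps} (((p>0 ∷ pos , lk) , (l∤p ∷ reg)) , (p≤1+k ∷ bd) , eq) with p ℕ.≟ suc k
  ... | yes ≡.refl = ∈-++⁺ʳ (regularPartitions l k n) (∈-map⁺ (suc k ∷_)
        (Equivalence.from (∈-regularPartitions l (suc k) m)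
          (((pos , linked-tail lk) , reg) , bd , ℕ.+-cancelˡ-≡ (suc k) _ _ eq)))
  ... | no p≢1+k = ∈-++⁺ˡ (Equivalence.from (∈-regularPartitions l k n)
        (((p>0 ∷ pos , lk) , (l∤p ∷ reg)) ,
         p≤k ∷ All.map (λ r≤p → ℕ.≤-trans r≤p p≤k) (linked-head lk) , eq))
    where
    p≤k : p ≤ k
    p≤k = ℕ.≤-pred (ℕ.≤∧≢⇒< p≤1+k p≢1+k)

  from : ∀ {ps} → ps ∈ regularPartitions l k n ++ withLargest → IsRegularPartition l (suc k) n ps
  from ps∈ with ∈-++⁻ (regularPartitions l k n) ps∈
  ... | inj₁ ps∈ˡ with Equivalence.to (∈-regularPartitions l k n) ps∈ˡ
  ...   | h , bd , eq = h , All.map ℕ.m≤n⇒m≤1+n bd , eq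
  from ps∈ | inj₂ ps∈ʳ with ∈-map⁻ (suc k ∷_) ps∈ʳ
  ... | qs , qs∈ , ≡.refl with Equivalence.to (∈-regularPartitions l (suc k) m) qs∈
  ...   | ((pos , lk) , reg) , bd , eq =
    ((s≤s z≤n ∷ pos , linked-cons bd lk) , (l∤1+k ∷ reg)) , ℕ.≤-refl ∷ bd , ≡.cong (suc k ℕ.+_) eq

count-zero-suc : ∀ l n → count l 0 (suc n) ≡ 0
count-zero-suc l n = equinumerous (regularPartitions-unique l 0 (suc n)) []
  (mk⇔ (λ ps∈ → ⊥-elim (impossible (Equivalence.to (∈-regularPartitions l 0 (suc n)) ps∈))) (λ ()))
  where
  impossible : ∀ {ps} → ¬ IsRegularPartition l 0 (suc n) ps
  impossible {_ ∷ _} (((p>0 ∷ _ , _) , _) , (p≤0 ∷ _) , _) = ℕ.n≮0 (ℕ.≤-trans p>0 p≤0)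

-- Bipartitions as a convolution of two families of partitions

module _ {a b} {A : Set a} {B : Set b} where

  length-cartesianProduct : ∀ (xs : List A) (ys : List B) → length (cartesianProduct xs ys) ≡ length xs ℕ.* length ys
  length-cartesianProduct []       ys = ≡.refl
  length-cartesianProduct (x ∷ xs) ys =
    ≡.trans (length-++ (map (x ,_) ys)) (≡.cong₂ ℕ._+_ (length-map (x ,_) ys) (length-cartesianProduct xs ys))

  -- The recursion copies that of `_⊛_`, so that lengths of convolutions become coefficients of
  -- products by the same induction.
  convolution : (ℕ → List A) → (ℕ → List B) → ℕ → List (A × B)
  convolution f g zero    = cartesianProduct (f 0) (g 0)
  convolution f g (suc n) = cartesianProduct (f 0) (g (suc n)) ++ convolution (f ∘ suc) g n

  ∈-convolution⁺ : ∀ f g i {j x y} → x ∈ f i → y ∈ g j → (x , y) ∈ convolution f g (i ℕ.+ j)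
  ∈-convolution⁺ f g zero    {zero}  x∈ y∈ = ∈-cartesianProduct⁺ x∈ y∈
  ∈-convolution⁺ f g zero    {suc j} x∈ y∈ = ∈-++⁺ˡ (∈-cartesianProduct⁺ x∈ y∈)
  ∈-convolution⁺ f g (suc i) {j}     x∈ y∈ =
    ∈-++⁺ʳ (cartesianProduct (f 0) (g (suc (i ℕ.+ j)))) (∈-convolution⁺ (f ∘ suc) g i x∈ y∈)

  ∈-convolution⁻ : ∀ f g n {x y} → (x , y) ∈ convolution f g n → ∃₂ λ i j → x ∈ f i × y ∈ g j × i ℕ.+ j ≡ n
  ∈-convolution⁻ f g zero xy∈ with ∈-cartesianProduct⁻ (f 0) (g 0) xy∈
  ... | x∈ , y∈ = 0 , 0 , x∈ , y∈ , ≡.refl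
  ∈-convolution⁻ f g (suc n) xy∈ with ∈-++⁻ (cartesianProduct (f 0) (g (suc n))) xy∈
  ... | inj₁ xy∈ˡ with ∈-cartesianProduct⁻ (f 0) (g (suc n)) xy∈ˡ
  ...   | x∈ , y∈ = 0 , suc n , x∈ , y∈ , ≡.refl
  ∈-convolution⁻ f g (suc n) xy∈ | inj₂ xy∈ʳ with ∈-convolution⁻ (f ∘ suc) g n xy∈ʳ
  ... | i , j , x∈ , y∈ , ≡.refl = suc i , j , x∈ , y∈ , ≡.refl

  -- Blocks with different first index cannot meet, because the first component determines its
  -- index; for partitions that index is the sum of the parts.
  convolution-unique : ∀ f g n → (∀ {i i′ x} → x ∈ f i → x ∈ f i′ → i ≡ i′) →
                       (∀ i → Unique (f i)) → (∀ j → Unique (g j)) → Unique (convolution f g n)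
  convolution-unique f g zero    separated f! g! = Unique.cartesianProduct⁺ (f! 0) (g! 0)
  convolution-unique f g (suc n) separated f! g! =
    Unique.++⁺ (Unique.cartesianProduct⁺ (f! 0) (g! (suc n)))
      (convolution-unique (f ∘ suc) g n (λ x∈ x∈′ → ℕ.suc-injective (separated x∈ x∈′)) (f! ∘ suc) g!)
      disjoint
    where
    disjoint : ∀ {xy} → ¬ (xy ∈ cartesianProduct (f 0) (g (suc n)) × xy ∈ convolution (f ∘ suc) g n)
    disjoint (xy∈ , xy∈′) with ∈-cartesianProduct⁻ (f 0) (g (suc n)) xy∈ | ∈-convolution⁻ (f ∘ suc) g n xy∈′
    ... | x∈ , _ | i , _ , x∈′ , _ with separated x∈ x∈′
    ...   | ()

allRegularPartitions : (l n : ℕ) → List (List ℕ)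
allRegularPartitions l n = regularPartitions l n n

B≡length-convolution : ∀ l m n → B l m n ≡ length (convolution (allRegularPartitions l) (allRegularPartitions m) n)
B≡length-convolution l m n = equinumerous (regularBipartitions-unique l m n)
  (convolution-unique (allRegularPartitions l) (allRegularPartitions m) n separated
    (λ i → regularPartitions-unique l i i) (λ j → regularPartitions-unique m j j))
  (mk⇔ (to ∘ Equivalence.to (∈-regularBipartitions l m n))
       (Equivalence.from (∈-regularBipartitions l m n) ∘ from))
  where
  separated : ∀ {i i′ ps} → ps ∈ allRegularPartitions l i → ps ∈ allRegularPartitions l i′ → i ≡ i′
  separated {i} {i′} ps∈ ps∈′
    with Equivalence.to (∈-regularPartitions l i i) ps∈ | Equivalence.to (∈-regularPartitions l i′ i′) ps∈′
  ... | _ , _ , eq | _ , _ , eq′ = ≡.trans (≡.sym eq) eq′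

  ∈-all : ∀ l {ps} → IsPartition ps × IsRegular l ps → ps ∈ allRegularPartitions l (sum ps)
  ∈-all l {ps} h = Equivalence.from (∈-regularPartitions l (sum ps) (sum ps)) (h , parts≤sum ps , ≡.refl)

  to : ∀ {pq} → IsRegularBipartition l m n pq → pq ∈ convolution (allRegularPartitions l) (allRegularPartitions m) n
  to {ps , qs} (hp , hq , ≡.refl) =
    ∈-convolution⁺ (allRegularPartitions l) (allRegularPartitions m) (sum ps) (∈-all l hp) (∈-all m hq)

  from : ∀ {pq} → pq ∈ convolution (allRegularPartitions l) (allRegularPartitions m) n → IsRegularBipartition l m n pq
  from {ps , qs} pq∈ with ∈-convolution⁻ (allRegularPartitions l) (allRegularPartitions m) n pq∈
  ... | i , j , ps∈ , qs∈ , eq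
    with Equivalence.to (∈-regularPartitions l i i) ps∈ | Equivalence.to (∈-regularPartitions m j j) qs∈
  ... | hp , _ , ≡.refl | hq , _ , ≡.refl = hp , hq , eq

-- Theta functions

module Theta {c ℓ : Level} (K : CommutativeRing c ℓ)
  (ℤ⟶K : ℤ.+-*-rawRing -Raw-AlmostCommutative⟶ fromCommutativeRing K) where

  open PowerSeries K
  open CommutativeRing commutativeRing
    hiding (zero)
  open Algebra.Properties.CommutativeSemiring.Exp commutativeSemiring
  open Relation.Binary.Reasoning.Setoid setoid

  private
    module K = CommutativeRing K
    module ι = _-Raw-AlmostCommutative⟶_ ℤ⟶K

  ⟨_⟩ : ℤ → Series
  ⟨ k ⟩ = constant ι.⟦ k ⟧

  constant-cong : ∀ {k l} → k K.≈ l → constant k ≈ constant l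
  constant-cong k≈l .at zero    = k≈l
  constant-cong k≈l .at (suc n) = K.refl

  ℤ⟶Series : ℤ.+-*-rawRing -Raw-AlmostCommutative⟶ fromCommutativeRing commutativeRing
  ℤ⟶Series = record
    { ⟦_⟧    = ⟨_⟩
    ; +-homo = λ k l → trans (constant-cong (ι.+-homo k l)) (constant-⊕ _ _)
    ; *-homo = λ k l → trans (constant-cong (ι.*-homo k l)) (constant-⊛ _ _)
    ; -‿homo = λ k → trans (constant-cong (ι.-‿homo k)) (constant-⊖ _)
    ; 0-homo = trans (constant-cong ι.0-homo) constant-0
    ; 1-homo = constant-cong ι.1-homo
    }

  private
    -- Coefficients are compared as integers. Different integers may have the same image in `K`, so
    -- a failed comparison refutes nothing and yields only `nothing`.
    _coeff≟_ : WeaklyDecidable (Induced-equivalence ℤ⟶Series)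
    a coeff≟ b with a ℤ.≟ b
    ... | yes ≡.refl = just refl
    ... | no  _      = nothing

  open Algebra.Solver.Ring ℤ.+-*-rawRing (fromCommutativeRing commutativeRing) ℤ⟶Series _coeff≟_
    using (solve; _:=_; _:+_; _:*_; _:-_; :-_; _:^_; con; Polynomial)

  -- The solver reads con (+ 1) as ⟨ + 1 ⟩, which is not 1# on the nose; an empty power is.
  :1 : ∀ {n} → Polynomial n
  :1 = con (+ 1) :^ 0

  -- The substitutions of q² and of -q for q

  V σ : Series → Series
  V = spread 1 0
  σ = negate

  V-cong : ∀ {A B} → A ≈ B → V A ≈ V B
  V-cong = spread-cong 1 0

  V-+ : ∀ A B → V (A + B) ≈ V A + V B
  V-+ = spread-⊕ 1 0

  V-neg : ∀ A → V (- A) ≈ - V A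
  V-neg = spread-⊖ 1 0

  V-* : ∀ A B → V (A * B) ≈ V A * V B
  V-* A B = sym (spread-⊛ 1 0 A B)

  V-1 : V 1# ≈ 1#
  V-1 = spread-constant 1 K.1#

  V-q : V q ≈ q * q
  V-q = trans (spread-q 1) (*-congˡ (*-identityʳ q))

  V-^ : ∀ A n → V (A ^ n) ≈ V A ^ n
  V-^ A zero    = V-1
  V-^ A (suc n) = trans (V-* A (A ^ n)) (*-congˡ (V-^ A n))

  σ-^ : ∀ A n → σ (A ^ n) ≈ σ A ^ n
  σ-^ A zero    = negate-constant K.1#
  σ-^ A (suc n) = trans (negate-⊛ A (A ^ n)) (*-congˡ (σ-^ A n))

  q^double : ∀ n → q ^ (n ℕ.* 2) ≈ (q * q) ^ n
  q^double zero    = refl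
  q^double (suc n) = trans (sym (*-assoc q q _)) (*-congˡ (q^double n))

  q^-vanishes : ∀ k A {i} → i < k → (A * q ^ k) i K.≈ K.0#
  q^-vanishes k A {i} i<k = K.trans (*-comm A (q ^ k) .at i) (q^-⊛-< k A i<k)

  -- The correction has order at least m + 1 and is invisible in the degrees that matter. In this
  -- way the finite identities shed their error terms.
  ⟶-perturbed : ∀ {a b A} → (∀ m → ∃ λ W → b m ≈ a m + W * q ^ suc m) → a ⟶ A → b ⟶ A
  ⟶-perturbed {a} {b} perturbed a⟶A {m} {i} i≤m with perturbed m
  ... | W , b≈ = K.trans (b≈ .at i) (K.trans (K.+-congˡ (q^-vanishes (suc m) W (s≤s i≤m)))
                   (K.trans (K.+-identityʳ (a m i)) (a⟶A i≤m)))

  factor-convergent : ∀ {u} (W : ℕ → Series) → (∀ j → u j ≈ 1# + W j * q ^ suc j) → Convergent u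
  factor-convergent W u≈ {j} {i} i≤j = K.trans (u≈ j .at i)
    (K.trans (K.+-congˡ (q^-vanishes (suc j) (W j) (s≤s i≤j))) (K.+-identityʳ _))

  -- In q-Pochhammer notation oddEuler = (q; q²)_∞, distinct = (-q; q)_∞ and euler p = (p; p)_∞,
  -- so that f = f₁ and F = f₂.
  o d : ℕ → Series
  o j = 1# - q * (q * q) ^ j
  d j = 1# + q ^ suc j

  e : Series → ℕ → Series
  e p j = 1# - p ^ suc j

  oddEuler distinct : Series
  oddEuler = ∏ o
  distinct = ∏ d

  euler : Series → Series
  euler p = ∏ (e p)

  o-convergent : Convergent o
  o-convergent = factor-convergent (λ j → - (q ^ j)) λ j → begin
    1# - q * (q * q) ^ j      ≈⟨ +-congˡ (-‿cong (*-congˡ (^-distrib-* q q j))) ⟩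
    1# - q * (q ^ j * q ^ j)
      ≈⟨ solve 2 (λ q p → :1 :- q :* (p :* p) := :1 :+ (:- p) :* (q :* p)) refl q (q ^ j) ⟩
    1# + - (q ^ j) * q ^ suc j ∎

  d-convergent : Convergent d
  d-convergent = factor-convergent (λ _ → 1#) λ j → +-congˡ (sym (*-identityˡ _))

  e-convergent : ∀ p A → p ≈ A * q → Convergent (e p)
  e-convergent p A p≈ = factor-convergent (λ j → - (A ^ suc j)) λ j → begin
    1# - p ^ suc j                  ≈⟨ +-congˡ (-‿cong (^-congˡ (suc j) p≈)) ⟩
    1# - (A * q) ^ suc j            ≈⟨ +-congˡ (-‿cong (^-distrib-* A q (suc j))) ⟩
    1# - A ^ suc j * q ^ suc j
      ≈⟨ solve 2 (λ a b → :1 :- a :* b := :1 :+ (:- a) :* b) refl (A ^ suc j) (q ^ suc j) ⟩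
    1# + - (A ^ suc j) * q ^ suc j  ∎

  f F : Series
  f = euler q
  F = euler (q * q)

  o⟶ : (λ m → ∏< m o) ⟶ oddEuler
  o⟶ = ∏<⟶∏ o-convergent

  d⟶ : (λ m → ∏< m d) ⟶ distinct
  d⟶ = ∏<⟶∏ d-convergent

  f⟶ : (λ m → ∏< m (e q)) ⟶ f
  f⟶ = ∏<⟶∏ (e-convergent q 1# (sym (*-identityˡ q)))

  F⟶ : (λ m → ∏< m (e (q * q))) ⟶ F
  F⟶ = ∏<⟶∏ (e-convergent (q * q) q refl)

  n≤n*2 : ∀ n → n ≤ n ℕ.* 2
  n≤n*2 n = ℕ.m≤m*n n 2

  euler-split : ∀ n → ∏< (n ℕ.* 2) (e q) ≈ ∏< n o * ∏< n (e (q * q))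
  euler-split zero    = sym (*-identityˡ 1#)
  euler-split (suc n) = begin
    ∏< (n ℕ.* 2) (e q) * (1# - q * q ^ (n ℕ.* 2)) * (1# - q * (q * q ^ (n ℕ.* 2)))
      ≈⟨ *-cong (*-cong (euler-split n) (+-congˡ (-‿cong (*-congˡ (q^double n)))))
                (+-congˡ (-‿cong (*-congˡ (*-congˡ (q^double n))))) ⟩
    ∏< n o * ∏< n (e (q * q)) * (1# - q * (q * q) ^ n) * (1# - q * (q * (q * q) ^ n))
      ≈⟨ solve 4 (λ a b q p → a :* b :* (:1 :- q :* p) :* (:1 :- q :* (q :* p))
                 := (a :* (:1 :- q :* p)) :* (b :* (:1 :- q :* q :* p)))
               refl (∏< n o) (∏< n (e (q * q))) q ((q * q) ^ n) ⟩
    ∏< (suc n) o * ∏< (suc n) (e (q * q)) ∎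

  f≈oF : f ≈ oddEuler * F
  f≈oF = ⟶-unique (⟶-subsequence (ℕ._* 2) n≤n*2 f⟶)
                  (⟶-cong (λ n → sym (euler-split n)) (⟶-⊛ o⟶ F⟶))

  euler-distinct : ∀ n → ∏< n (e q) * ∏< n d ≈ ∏< n (e (q * q))
  euler-distinct zero    = *-identityˡ 1#
  euler-distinct (suc n) = begin
    ∏< n (e q) * (1# - q ^ suc n) * (∏< n d * (1# + q ^ suc n))
      ≈⟨ solve 3 (λ a b p → a :* (:1 :- p) :* (b :* (:1 :+ p)) := a :* b :* (:1 :- p :* p))
               refl (∏< n (e q)) (∏< n d) (q ^ suc n) ⟩
    ∏< n (e q) * ∏< n d * (1# - q ^ suc n * q ^ suc n)
      ≈⟨ *-cong (euler-distinct n) (+-congˡ (-‿cong (sym (^-distrib-* q q (suc n))))) ⟩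
    ∏< (suc n) (e (q * q)) ∎

  fd≈F : f * distinct ≈ F
  fd≈F = ⟶-unique (⟶-⊛ f⟶ d⟶) (⟶-cong (λ n → sym (euler-distinct n)) F⟶)

  -- Euler's theorem on partitions into odd and into distinct parts, as an identity of products. It
  -- supplies an inverse of `oddEuler`, so that dividing by `oddEuler` becomes multiplying by
  -- `distinct`.
  od≈1 : oddEuler * distinct ≈ 1#
  od≈1 = ⊛-cancelʳ {F} K.refl (begin
    oddEuler * distinct * F  ≈⟨ solve 3 (λ a b c → a :* b :* c := a :* c :* b) refl oddEuler distinct F ⟩
    oddEuler * F * distinct  ≈⟨ *-congʳ f≈oF ⟨
    f * distinct             ≈⟨ fd≈F ⟩
    F                        ≈⟨ *-identityˡ F ⟨
    1# * F                   ∎)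

  -- Gauss's ψ(q)

  -- t n = q ^ (n (n + 1) / 2).
  t ψ< : ℕ → Series
  t zero    = 1#
  t (suc n) = t n * q ^ suc n
  ψ< zero    = 1#
  ψ< (suc n) = ψ< n + t (suc n)

  Ψ : Series
  Ψ n = ψ< n n

  ψ⟶ : ψ< ⟶ Ψ
  ψ⟶ = ⟶-diagonal {ψ<} λ {m} i≤m →
    K.trans (K.+-congˡ (q^-vanishes (suc m) (t m) (s≤s i≤m))) (K.+-identityʳ _)

  -- With x = q^(2s+3) these are the numerators of Shanks's finite form of Gauss's identity; keeping x
  -- free makes the passage from s to s + 1 an induction on L-shift.
  L : ℕ → Series → Series
  L zero    x = 1# - q * q
  L (suc s) x = (L s x + ∏< (suc s) o * x ^ suc s) * (1# - (q * q) ^ suc (suc s))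

  L-cong : ∀ s {x y} → x ≈ y → L s x ≈ L s y
  L-cong zero    x≈y = refl
  L-cong (suc s) x≈y = *-congʳ (+-cong (L-cong s x≈y) (*-congˡ (^-congˡ (suc s) x≈y)))

  -- A q-difference equation in x, tailored to x = q^(2s+3): there 1 - x is the next odd factor `o`
  -- (s + 1), and 1 - q x is the factor that appears in `L` (s + 1).
  L-shift : ∀ s x → (1# - q * x) * L s (q * q * x) ≈
            (1# - x) * L s x + ∏< (suc s) o * (1# - (q * q) ^ suc s) * x ^ suc s
  L-shift zero    x = solve 2 (λ q x → (:1 :- q :* x) :* (:1 :- q :* q) :=
    (:1 :- x) :* (:1 :- q :* q) :+ :1 :* (:1 :- q :* :1) :* (:1 :- q :* q :* :1) :* (x :* :1)) refl q x
  L-shift (suc s) x = begin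
    (1# - q * x) * ((L s (q * q * x) + O * (q * q * x) ^ suc s) * (1# - q * q * p))
      ≈⟨ *-congˡ (*-congʳ (+-congˡ (*-congˡ (^-distrib-* (q * q) x (suc s))))) ⟩
    (1# - q * x) * ((L s (q * q * x) + O * (p * y)) * (1# - q * q * p))
      ≈⟨ solve 6 (λ q x l o p y → (:1 :- q :* x) :* ((l :+ o :* (p :* y)) :* (:1 :- q :* q :* p)) :=
           ((:1 :- q :* x) :* l :+ (:1 :- q :* x) :* o :* (p :* y)) :* (:1 :- q :* q :* p))
           refl q x (L s (q * q * x)) O p y ⟩
    ((1# - q * x) * L s (q * q * x) + (1# - q * x) * O * (p * y)) * (1# - q * q * p)
      ≈⟨ *-congʳ (+-congʳ (L-shift s x)) ⟩
    ((1# - x) * L s x + O * (1# - p) * y + (1# - q * x) * O * (p * y)) * (1# - q * q * p)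
      ≈⟨ solve 6 (λ q x l o p y →
           ((:1 :- x) :* l :+ o :* (:1 :- p) :* y :+ (:1 :- q :* x) :* o :* (p :* y)) :* (:1 :- q :* q :* p) :=
           (:1 :- x) :* ((l :+ o :* y) :* (:1 :- q :* q :* p)) :+
             o :* (:1 :- q :* p) :* (:1 :- q :* q :* p) :* (x :* y))
           refl q x (L s x) O p y ⟩
    (1# - x) * L (suc s) x + ∏< (suc (suc s)) o * (1# - (q * q) ^ suc (suc s)) * x ^ suc (suc s) ∎
    where
    O p y : Series
    O = ∏< (suc s) o
    p = (q * q) ^ suc s
    y = x ^ suc s

  -- The exponent 2n(2n + 1)/2 is n(2n + 1). In this form the new terms of ψ are the powers of x
  -- that occur in `L`.
  t-double : ∀ n → t (n ℕ.* 2) ≈ (q * (q * q) ^ n) ^ n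
  t-double zero    = refl
  t-double (suc n) = begin
    t (n ℕ.* 2) * (q * q ^ (n ℕ.* 2)) * (q * (q * q ^ (n ℕ.* 2)))
      ≈⟨ *-cong (*-cong (t-double n) (*-congˡ (q^double n))) (*-congˡ (*-congˡ (q^double n))) ⟩
    x ^ n * x * (q * (q * p))
      ≈⟨ solve 3 (λ y q p → y :* (q :* p) :* (q :* (q :* p)) := (q :* p) :* y :* ((q :* q) :* p))
           refl (x ^ n) q p ⟩
    x ^ suc n * (q * q) ^ suc n
      ≈⟨ ^-distrib-* x (q * q) (suc n) ⟨
    (x * (q * q)) ^ suc n
      ≈⟨ ^-congˡ (suc n) (solve 2 (λ q p → q :* p :* (q :* q) := q :* (q :* q :* p)) refl q p) ⟩
    (q * (q * q) ^ suc n) ^ suc n ∎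
    where
    p x : Series
    p = (q * q) ^ n
    x = q * p

  -- The partial sum of ψ runs up to index 2m + 1, so each induction step brings one new odd factor
  -- and two new terms.
  shanks-ψ : ∀ m → ∏< (suc m) o * ψ< (suc (m ℕ.* 2)) ≈ L m (q * (q * q) ^ suc m)
  shanks-ψ zero    = solve 1 (λ q → :1 :* (:1 :- q :* :1) :* (:1 :+ :1 :* (q :* :1)) := :1 :- q :* q) refl q
  shanks-ψ (suc m) = begin
    O * (1# - q * p) * (ψ + t (n ℕ.* 2) + t (n ℕ.* 2) * (q * q ^ (n ℕ.* 2)))
      ≈⟨ *-congˡ (+-cong (+-congˡ (t-double n)) (*-cong (t-double n) (*-congˡ (q^double n)))) ⟩
    O * (1# - q * p) * (ψ + y + y * (q * p))
      ≈⟨ solve 5 (λ q o ψ y p → o :* (:1 :- q :* p) :* (ψ :+ y :+ y :* (q :* p)) :=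
           (:1 :- q :* p) :* (o :* ψ) :+ o :* (:1 :- p) :* y :+ (:1 :- q :* (q :* p)) :* o :* (p :* y))
           refl q O ψ y p ⟩
    (1# - x) * (O * ψ) + O * (1# - p) * y + (1# - q * x) * O * (p * y)
      ≈⟨ +-congʳ (+-congʳ (*-congˡ (shanks-ψ m))) ⟩
    (1# - x) * L m x + O * (1# - p) * y + (1# - q * x) * O * (p * y)
      -- The first two summands are the right side of `L-shift` at x, and the third is the summand
      -- by which `L` n extends `L` m; both now carry the common factor 1 - q x.
      ≈⟨ +-cong (sym (L-shift m x)) (*-congˡ (sym (^-distrib-* (q * q) x n))) ⟩
    (1# - q * x) * L m (q * q * x) + (1# - q * x) * O * (q * q * x) ^ n
      ≈⟨ solve 5 (λ q p l o z → (:1 :- q :* (q :* p)) :* l :+ (:1 :- q :* (q :* p)) :* o :* z :=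
           (l :+ o :* z) :* (:1 :- q :* q :* p)) refl q p (L m (q * q * x)) O ((q * q * x) ^ n) ⟩
    L n (q * q * x)
      ≈⟨ L-cong n (solve 2 (λ q p → q :* q :* (q :* p) := q :* (q :* q :* p)) refl q p) ⟩
    L n (q * (q * q) ^ suc n) ∎
    where
    n = suc m
    O ψ p x y : Series
    O = ∏< n o
    ψ = ψ< (suc (m ℕ.* 2))
    p = (q * q) ^ n
    x = q * p
    y = x ^ n

  -- At x = 0 only the partial product of `F` is left. For x = q^(2s+3) the rest has order greater
  -- than s, so the limit is `F`.
  L-perturbed : ∀ s x → ∃ λ W → L s x ≈ ∏< (suc s) (e (q * q)) + W * x
  L-perturbed zero    x = ⟨ + 0 ⟩ ,
    solve 2 (λ q x → :1 :- q :* q := :1 :* (:1 :- q :* q :* :1) :+ con (+ 0) :* x) refl q x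
  L-perturbed (suc s) x with L-perturbed s x
  ... | W , L≈ = (W + ∏< (suc s) o * x ^ s) * e (q * q) (suc s) , (begin
    (L s x + ∏< (suc s) o * (x * x ^ s)) * e (q * q) (suc s)
      ≈⟨ *-congʳ (+-congʳ L≈) ⟩
    (∏< (suc s) (e (q * q)) + W * x + ∏< (suc s) o * (x * x ^ s)) * e (q * q) (suc s)
      ≈⟨ solve 6 (λ E W x o y c → (E :+ W :* x :+ o :* (x :* y)) :* c := E :* c :+ (W :+ o :* y) :* c :* x)
           refl (∏< (suc s) (e (q * q))) W x (∏< (suc s) o) (x ^ s) (e (q * q) (suc s)) ⟩
    ∏< (suc (suc s)) (e (q * q)) + (W + ∏< (suc s) o * x ^ s) * e (q * q) (suc s) * x ∎)

  oΨ≈F : oddEuler * Ψ ≈ F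
  oΨ≈F = ⟶-unique
    (⟶-⊛ (⟶-subsequence suc ℕ.n≤1+n o⟶)
         (⟶-subsequence (λ m → suc (m ℕ.* 2)) (λ m → ℕ.m≤n⇒m≤1+n (n≤n*2 m)) ψ⟶))
    (⟶-cong (λ m → sym (shanks-ψ m)) (⟶-perturbed perturbed (⟶-subsequence suc ℕ.n≤1+n F⟶)))
    where
    perturbed : ∀ m → ∃ λ W → L m (q * (q * q) ^ suc m) ≈ ∏< (suc m) (e (q * q)) + W * q ^ suc m
    perturbed m with L-perturbed m (q * (q * q) ^ suc m)
    ... | W , L≈ = W * (q * q ^ suc m) , trans L≈ (+-congˡ (begin
      W * (q * (q * q) ^ suc m)          ≈⟨ *-congˡ (*-congˡ (^-distrib-* q q (suc m))) ⟩
      W * (q * (q ^ suc m * q ^ suc m))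
        ≈⟨ solve 3 (λ w q p → w :* (q :* (p :* p)) := w :* (q :* p) :* p) refl W q (q ^ suc m) ⟩
      W * (q * q ^ suc m) * q ^ suc m    ∎))

  -- Gauss's φ(-q)

  -- u n = (-1)^n q^(n²) and T = φ(-q).
  u Θ< : ℕ → Series
  u zero    = 1#
  u (suc n) = u n * - (q * (q * q) ^ n)
  Θ< zero    = 1#
  Θ< (suc n) = Θ< n + ⟨ + 2 ⟩ * u (suc n)

  T : Series
  T n = Θ< n n

  -- Writing q^(n²) as the n-th power of q^n turns the terms of φ(-q) into the powers of -x that
  -- occur in `M`.
  u-power : ∀ n → u n ≈ (- (q ^ n)) ^ n
  u-power zero    = refl
  u-power (suc n) = begin
    u n * - (q * (q * q) ^ n)
      ≈⟨ *-cong (u-power n) (-‿cong (*-congˡ (^-distrib-* q q n))) ⟩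
    (- p) ^ n * - (q * (p * p))
      ≈⟨ solve 3 (λ z q p → z :* (:- (q :* (p :* p))) := (:- p) :* z :* (q :* p)) refl ((- p) ^ n) q p ⟩
    (- p) ^ suc n * q ^ suc n
      ≈⟨ ^-distrib-* (- p) q (suc n) ⟨
    (- p * q) ^ suc n
      ≈⟨ ^-congˡ (suc n) (solve 2 (λ q p → (:- p) :* q := :- (q :* p)) refl q p) ⟩
    (- (q ^ suc n)) ^ suc n ∎
    where
    p : Series
    p = q ^ n

  Θ⟶ : Θ< ⟶ T
  Θ⟶ = ⟶-diagonal {Θ<} λ {m} {i} i≤m → K.trans (K.+-congˡ (K.trans (u-multiple m .at i)
           (q^-vanishes (suc m) (⟨ + 2 ⟩ * (- (q ^ m * u m))) (s≤s i≤m)))) (K.+-identityʳ _)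
    where
    u-multiple : ∀ m → ⟨ + 2 ⟩ * u (suc m) ≈ ⟨ + 2 ⟩ * (- (q ^ m * u m)) * q ^ suc m
    u-multiple m = trans (*-congˡ (*-congˡ (-‿cong (*-congˡ (^-distrib-* q q m)))))
      (solve 4 (λ c q p y → c :* (y :* (:- (q :* (p :* p)))) := c :* (:- (p :* y)) :* (q :* p))
        refl ⟨ + 2 ⟩ q (q ^ m) (u m))

  -- The analogue of L for φ(-q), to be evaluated at x = q^(s+1).
  M : ℕ → Series → Series
  M zero    x = 1#
  M (suc s) x = (1# - q ^ suc s) * M s x + ⟨ + 2 ⟩ * ∏< s d * (- x) ^ suc s

  negate-power : ∀ x n → (- (q * x)) ^ n ≈ q ^ n * (- x) ^ n
  negate-power x n = trans (^-congˡ n (solve 2 (λ q x → :- (q :* x) := q :* (:- x)) refl q x)) (^-distrib-* q (- x) n)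

  -- The counterpart of `L-shift`: at x = q^(s+1) the factor 1 + x is the next factor `d` s, and 1 -
  -- x is the factor that appears in `M` (s + 1).
  M-shift : ∀ s x → (1# - x) * M s (q * x) ≈ (1# + x) * M s x + ⟨ + 2 ⟩ * ∏< s d * (- x) ^ suc s
  M-shift zero    x = solve 1 (λ x → (:1 :- x) :* :1 := (:1 :+ x) :* :1 :+ con (+ 2) :* :1 :* ((:- x) :* :1)) refl x
  M-shift (suc s) x = begin
    (1# - x) * ((1# - p) * M s (q * x) + ⟨ + 2 ⟩ * D * (- (q * x)) ^ suc s)
      ≈⟨ *-congˡ (+-congˡ (*-congˡ (negate-power x (suc s)))) ⟩
    (1# - x) * ((1# - p) * M s (q * x) + ⟨ + 2 ⟩ * D * (p * y))
      ≈⟨ solve 5 (λ x p m d y → (:1 :- x) :* ((:1 :- p) :* m :+ con (+ 2) :* d :* (p :* y)) :=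
           (:1 :- p) :* ((:1 :- x) :* m) :+ (:1 :- x) :* (con (+ 2) :* d :* (p :* y)))
           refl x p (M s (q * x)) D y ⟩
    (1# - p) * ((1# - x) * M s (q * x)) + (1# - x) * (⟨ + 2 ⟩ * D * (p * y))
      ≈⟨ +-congʳ (*-congˡ (M-shift s x)) ⟩
    (1# - p) * ((1# + x) * M s x + ⟨ + 2 ⟩ * D * y) + (1# - x) * (⟨ + 2 ⟩ * D * (p * y))
      ≈⟨ solve 5 (λ x p m d y →
           (:1 :- p) :* ((:1 :+ x) :* m :+ con (+ 2) :* d :* y) :+ (:1 :- x) :* (con (+ 2) :* d :* (p :* y)) :=
           (:1 :+ x) :* ((:1 :- p) :* m :+ con (+ 2) :* d :* y) :+ con (+ 2) :* (d :* (:1 :+ p)) :* ((:- x) :* y))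
           refl x p (M s x) D y ⟩
    (1# + x) * M (suc s) x + ⟨ + 2 ⟩ * ∏< (suc s) d * (- x) ^ suc (suc s) ∎
    where
    D p y : Series
    D = ∏< s d
    p = q ^ suc s
    y = (- x) ^ suc s

  shanks-φ : ∀ n → ∏< n d * Θ< n ≈ M n (q ^ suc n)
  shanks-φ zero    = *-identityˡ 1#
  shanks-φ (suc n) = begin
    D * (1# + x) * (Θ< n + ⟨ + 2 ⟩ * u (suc n))
      ≈⟨ *-congˡ (+-congˡ (*-congˡ (u-power (suc n)))) ⟩
    D * (1# + x) * (Θ< n + ⟨ + 2 ⟩ * y)
      ≈⟨ solve 4 (λ d x θ y → d :* (:1 :+ x) :* (θ :+ con (+ 2) :* y) :=
           (:1 :+ x) :* (d :* θ) :+ con (+ 2) :* d :* y :+ con (+ 2) :* d :* (x :* y)) refl D x (Θ< n) y ⟩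
    (1# + x) * (D * Θ< n) + ⟨ + 2 ⟩ * D * y + ⟨ + 2 ⟩ * D * (x * y)
      ≈⟨ +-congʳ (+-congʳ (*-congˡ (shanks-φ n))) ⟩
    (1# + x) * M n x + ⟨ + 2 ⟩ * D * y + ⟨ + 2 ⟩ * D * (x * y)
      -- Here x is used twice over: as the argument of `M`, and as the power q^(n+1) that changes
      -- (-x)^(n+1) into (-q x)^(n+1).
      ≈⟨ +-cong (sym (M-shift n x)) (*-congˡ (sym (negate-power x (suc n)))) ⟩
    (1# - x) * M n (q * x) + ⟨ + 2 ⟩ * D * (- (q * x)) ^ suc n ∎
    where
    D x y : Series
    D = ∏< n d
    x = q ^ suc n
    y = (- x) ^ suc n

  M-perturbed : ∀ s x → ∃ λ W → M s x ≈ ∏< s (e q) + W * x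
  M-perturbed zero    x = ⟨ + 0 ⟩ , solve 1 (λ x → :1 := :1 :+ con (+ 0) :* x) refl x
  M-perturbed (suc s) x with M-perturbed s x
  ... | W , M≈ = (1# - q ^ suc s) * W - ⟨ + 2 ⟩ * ∏< s d * (- x) ^ s ,
    trans (+-congʳ (*-congˡ M≈))
      (solve 6 (λ p E W x d y → (:1 :- p) :* (E :+ W :* x) :+ con (+ 2) :* d :* ((:- x) :* y) :=
          E :* (:1 :- p) :+ ((:1 :- p) :* W :- con (+ 2) :* d :* y) :* x)
        refl (q ^ suc s) (∏< s (e q)) W x (∏< s d) ((- x) ^ s))

  dT≈f : distinct * T ≈ f
  dT≈f = ⟶-unique (⟶-⊛ d⟶ Θ⟶)
    (⟶-cong (λ m → sym (shanks-φ m)) (⟶-perturbed (λ m → M-perturbed m (q ^ suc m)) f⟶))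

  -- This is f₁²/f₂ with the quotient f₁/f₂ written as `oddEuler`, a form to which substitutions
  -- apply factor by factor.
  T≈o²F : T ≈ oddEuler * oddEuler * F
  T≈o²F = begin
    T                                  ≈⟨ *-identityˡ T ⟨
    1# * T                             ≈⟨ *-congʳ od≈1 ⟨
    oddEuler * distinct * T            ≈⟨ *-assoc oddEuler distinct T ⟩
    oddEuler * (distinct * T)          ≈⟨ *-congˡ (trans dT≈f f≈oF) ⟩
    oddEuler * (oddEuler * F)          ≈⟨ *-assoc oddEuler oddEuler F ⟨
    oddEuler * oddEuler * F            ∎

  Ψ≈dF : Ψ ≈ distinct * F
  Ψ≈dF = begin
    Ψ                                  ≈⟨ *-identityˡ Ψ ⟨
    1# * Ψ                             ≈⟨ *-congʳ od≈1 ⟨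
    oddEuler * distinct * Ψ
      ≈⟨ solve 3 (λ o d ψ → o :* d :* ψ := d :* (o :* ψ)) refl oddEuler distinct Ψ ⟩
    distinct * (oddEuler * Ψ)          ≈⟨ *-congˡ oΨ≈F ⟩
    distinct * F                       ∎

  -- Dissections

  V-e : ∀ p j → V (e p j) ≈ e (V p) j
  V-e p j = begin
    V (1# - p ^ suc j)        ≈⟨ V-+ 1# (- (p ^ suc j)) ⟩
    V 1# + V (- (p ^ suc j))  ≈⟨ +-cong V-1 (trans (V-neg (p ^ suc j)) (-‿cong (V-^ p (suc j)))) ⟩
    1# - V p ^ suc j          ∎

  V-euler : ∀ {p} → Convergent (e p) → Convergent (e (V p)) → V (euler p) ≈ euler (V p)
  V-euler {p} conv convV = ⟶-unique
    (⟶-cong (λ m → trans (∏<-spread 1 m (e p)) (∏<-cong m (V-e p))) (⟶-spread 1 (∏<⟶∏ conv)))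
    (∏<⟶∏ convV)

  e-cong : ∀ {p p′} → p ≈ p′ → ∀ j → e p j ≈ e p′ j
  e-cong p≈p′ j = +-congˡ (-‿cong (^-congˡ (suc j) p≈p′))

  euler-cong : ∀ {p p′} → p ≈ p′ → euler p ≈ euler p′
  euler-cong p≈p′ .at n = ∏<-cong n (e-cong p≈p′) .at n

  F≈Vf : F ≈ V f
  F≈Vf = sym (trans (V-euler (e-convergent q 1# (sym (*-identityˡ q))) (e-convergent (V q) q V-q)) (euler-cong V-q))

  F≈VoVF : F ≈ V oddEuler * V F
  F≈VoVF = trans F≈Vf (trans (V-cong f≈oF) (V-* oddEuler F))

  σ-o : ∀ j → σ (o j) ≈ 1# + q * (q * q) ^ j
  σ-o j = begin
    σ (1# - x)                 ≈⟨ negate-⊕ 1# (- x) ⟩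
    σ 1# + σ (- x)             ≈⟨ +-cong (negate-constant K.1#) (negate-⊖ x) ⟩
    1# - σ x                   ≈⟨ +-congˡ (-‿cong (trans (negate-⊛ q ((q * q) ^ j)) (*-cong negate-q even))) ⟩
    1# - (- q) * (q * q) ^ j   ≈⟨ solve 2 (λ q p → :1 :- (:- q) :* p := :1 :+ q :* p) refl q ((q * q) ^ j) ⟩
    1# + q * (q * q) ^ j       ∎
    where
    x : Series
    x = q * (q * q) ^ j
    even : σ ((q * q) ^ j) ≈ (q * q) ^ j
    even = begin
      σ ((q * q) ^ j)  ≈⟨ σ-^ (q * q) j ⟩
      σ (q * q) ^ j    ≈⟨ ^-congˡ j (trans (negate-⊛ q q) (*-cong negate-q negate-q)) ⟩
      (- q * - q) ^ j  ≈⟨ ^-congˡ j (solve 1 (λ q → (:- q) :* (:- q) := q :* q) refl q) ⟩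
      (q * q) ^ j      ∎

  -- All exponents in `oddEuler` are odd, so `σ` changes each factor 1 - y into 1 + y, and 1 - y² is
  -- the same factor at q².
  oσo≈Vo : oddEuler * σ oddEuler ≈ V oddEuler
  oσo≈Vo = ⟶-unique (⟶-⊛ o⟶ (⟶-negate o⟶)) (⟶-cong (λ m → sym (finite m)) (⟶-spread 1 o⟶))
    where
    finite : ∀ m → ∏< m o * σ (∏< m o) ≈ V (∏< m o)
    finite zero    = trans (*-identityˡ (σ 1#)) (trans (negate-constant K.1#) (sym V-1))
    finite (suc m) = begin
      O * o m * σ (O * o m)
        ≈⟨ *-congˡ (trans (negate-⊛ O (o m)) (*-congˡ (σ-o m))) ⟩
      O * (1# - q * p) * (σ O * (1# + q * p))
        ≈⟨ solve 4 (λ a b q p → a :* (:1 :- q :* p) :* (b :* (:1 :+ q :* p)) :=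
             a :* b :* (:1 :- q :* q :* (p :* p))) refl O (σ O) q p ⟩
      O * σ O * (1# - q * q * (p * p))
        ≈⟨ *-cong (finite m) (+-congˡ (-‿cong (*-congˡ (sym (^-distrib-* (q * q) (q * q) m))))) ⟩
      V O * (1# - q * q * (q * q * (q * q)) ^ m)
        ≈⟨ *-congˡ (begin
             V (1# - q * p)                      ≈⟨ V-+ 1# (- (q * p)) ⟩
             V 1# + V (- (q * p))                ≈⟨ +-cong V-1 (V-neg (q * p)) ⟩
             1# - V (q * p)                      ≈⟨ +-congˡ (-‿cong (V-* q p)) ⟩
             1# - V q * V p                      ≈⟨ +-congˡ (-‿cong (*-cong V-q (trans (V-^ (q * q) m)
                                                     (^-congˡ m (trans (V-* q q) (*-cong V-q V-q)))))) ⟩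
             1# - q * q * (q * q * (q * q)) ^ m  ∎) ⟨
      V O * V (o m)
        ≈⟨ V-* O (o m) ⟨
      V (O * o m) ∎
      where
      O p : Series
      O = ∏< m o
      p = (q * q) ^ m

  σF≈F : σ F ≈ F
  σF≈F = trans (negate-cong F≈Vf) (trans (negate-spread f) (sym F≈Vf))

  σT≈ : σ T ≈ σ oddEuler * σ oddEuler * F
  σT≈ = begin
    σ T                                   ≈⟨ negate-cong T≈o²F ⟩
    σ (oddEuler * oddEuler * F)           ≈⟨ negate-⊛ (oddEuler * oddEuler) F ⟩
    σ (oddEuler * oddEuler) * σ F         ≈⟨ *-cong (negate-⊛ oddEuler oddEuler) σF≈F ⟩
    σ oddEuler * σ oddEuler * F           ∎

  -- Grouping `oddEuler` with its image under `σ` makes everything a series in q². The purpose is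
  -- parity: multiplying by `σ T` changes a factor `T` into one that passes through an extraction of
  -- odd coefficients.
  TσT≈VT² : T * σ T ≈ V (T * T)
  TσT≈VT² = begin
    T * σ T
      ≈⟨ *-cong T≈o²F σT≈ ⟩
    oddEuler * oddEuler * F * (σ oddEuler * σ oddEuler * F)
      ≈⟨ solve 3 (λ a b c → a :* a :* c :* (b :* b :* c) := a :* b :* (a :* b) :* (c :* c))
           refl oddEuler (σ oddEuler) F ⟩
    oddEuler * σ oddEuler * (oddEuler * σ oddEuler) * (F * F)
      ≈⟨ *-cong (*-cong oσo≈Vo oσo≈Vo) (*-cong F≈VoVF F≈VoVF) ⟩
    V oddEuler * V oddEuler * (V oddEuler * V F * (V oddEuler * V F))
      ≈⟨ solve 2 (λ a b → a :* a :* (a :* b :* (a :* b)) := a :* a :* b :* (a :* a :* b))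
           refl (V oddEuler) (V F) ⟩
    V oddEuler * V oddEuler * V F * (V oddEuler * V oddEuler * V F)
      ≈⟨ *-cong VT VT ⟨
    V T * V T
      ≈⟨ V-* T T ⟨
    V (T * T) ∎
    where
    VT : V T ≈ V oddEuler * V oddEuler * V F
    VT = trans (V-cong T≈o²F) (trans (V-* (oddEuler * oddEuler) F) (*-congʳ (V-* oddEuler oddEuler)))

  -- Since `distinct` inverts `oddEuler`, the product of `oddEuler` and its sign change gives
  -- `σ oddEuler` as `V oddEuler` times `distinct`. Both sides then become the square of `distinct`
  -- times `F`.
  Ψ²≈σTVΨ : Ψ * Ψ ≈ σ T * V Ψ
  Ψ²≈σTVΨ = sym (begin
    σ T * V Ψ
      ≈⟨ *-congʳ (trans σT≈ (*-congʳ (*-cong σo≈ σo≈))) ⟩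
    V oddEuler * distinct * (V oddEuler * distinct) * F * V Ψ
      ≈⟨ solve 4 (λ o d F ψ → o :* d :* (o :* d) :* F :* ψ := d :* d :* F :* (o :* (o :* ψ)))
           refl (V oddEuler) distinct F (V Ψ) ⟩
    distinct * distinct * F * (V oddEuler * (V oddEuler * V Ψ))
      ≈⟨ *-congˡ (*-congˡ (trans (sym (V-* oddEuler Ψ)) (V-cong oΨ≈F))) ⟩
    distinct * distinct * F * (V oddEuler * V F)
      ≈⟨ *-congˡ F≈VoVF ⟨
    distinct * distinct * F * F
      ≈⟨ solve 2 (λ d F → d :* d :* F :* F := d :* F :* (d :* F)) refl distinct F ⟩
    distinct * F * (distinct * F)
      ≈⟨ *-cong Ψ≈dF Ψ≈dF ⟨
    Ψ * Ψ ∎)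
    where
    σo≈ : σ oddEuler ≈ V oddEuler * distinct
    σo≈ = begin
      σ oddEuler                          ≈⟨ *-identityˡ _ ⟨
      1# * σ oddEuler                     ≈⟨ *-congʳ od≈1 ⟨
      oddEuler * distinct * σ oddEuler
        ≈⟨ solve 3 (λ a b c → a :* b :* c := a :* c :* b) refl oddEuler distinct (σ oddEuler) ⟩
      oddEuler * σ oddEuler * distinct    ≈⟨ *-congʳ oσo≈Vo ⟩
      V oddEuler * distinct               ∎

  -- Splitting φ and φ² by the parity of the exponent

  V² V³ : Series → Series
  V² A = V (V A)
  V³ A = V (V² A)

  V²-+ : ∀ A B → V² (A + B) ≈ V² A + V² B
  V²-+ A B = trans (V-cong (V-+ A B)) (V-+ (V A) (V B))

  V²-* : ∀ A B → V² (A * B) ≈ V² A * V² B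
  V²-* A B = trans (V-cong (V-* A B)) (V-* (V A) (V B))

  q⁴ q⁸ : Series
  q⁴ = q * q * (q * q)
  q⁸ = q⁴ * q⁴

  V²-q : V² q ≈ q⁴
  V²-q = trans (V-cong V-q) (trans (V-* q q) (*-cong V-q V-q))

  V-q⁴ : V q⁴ ≈ q⁸
  V-q⁴ = trans (V-* (q * q) (q * q)) (*-cong V-q² V-q²)
    where
    V-q² : V (q * q) ≈ q⁴
    V-q² = trans (V-* q q) (*-cong V-q V-q)

  q⁸^ : ∀ n → q⁸ ^ n ≈ (q * q) ^ (n ℕ.* 2) * (q * q) ^ (n ℕ.* 2)
  q⁸^ zero    = sym (*-identityˡ 1#)
  q⁸^ (suc n) = trans (*-congˡ (q⁸^ n))
    (solve 2 (λ q p → q :* q :* (q :* q) :* (q :* q :* (q :* q)) :* (p :* p) :=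
       q :* q :* (q :* q :* p) :* (q :* q :* (q :* q :* p))) refl q ((q * q) ^ (n ℕ.* 2)))

  σ-u : ∀ n → σ (u (suc n)) ≈ σ (u n) * (q * (q * q) ^ n)
  σ-u n = begin
    σ (u n * - x)                     ≈⟨ negate-⊛ (u n) (- x) ⟩
    σ (u n) * σ (- x)                 ≈⟨ *-congˡ (negate-⊖ x) ⟩
    σ (u n) * - σ x                   ≈⟨ *-congˡ (-‿cong σx) ⟩
    σ (u n) * - - x                   ≈⟨ solve 2 (λ a x → a :* (:- (:- x)) := a :* x) refl (σ (u n)) x ⟩
    σ (u n) * x                       ∎
    where
    x : Series
    x = q * (q * q) ^ n
    σx : σ x ≈ - x
    σx = begin
      σ (q * (q * q) ^ n)          ≈⟨ negate-⊛ q ((q * q) ^ n) ⟩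
      σ q * σ ((q * q) ^ n)
        ≈⟨ *-cong negate-q (trans (σ-^ (q * q) n) (^-congˡ n (trans (negate-⊛ q q) (*-cong negate-q negate-q)))) ⟩
      - q * (- q * - q) ^ n        ≈⟨ *-congˡ (^-congˡ n (solve 1 (λ q → (:- q) :* (:- q) := q :* q) refl q)) ⟩
      - q * (q * q) ^ n            ≈⟨ solve 2 (λ q p → (:- q) :* p := :- (q :* p)) refl q ((q * q) ^ n) ⟩
      - (q * (q * q) ^ n)          ∎

  u-even : ∀ n → u (n ℕ.* 2) ≈ V² (σ (u n))
  u-even zero    = sym (trans (V-cong (V-cong (negate-constant K.1#))) (trans (V-cong V-1) V-1))
  u-even (suc n) = begin
    u (n ℕ.* 2) * - (q * p) * - (q * (q * q * p))
      ≈⟨ *-congʳ (*-congʳ (u-even n)) ⟩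
    V² (σ (u n)) * - (q * p) * - (q * (q * q * p))
      ≈⟨ solve 3 (λ a q p → a :* (:- (q :* p)) :* (:- (q :* (q :* q :* p))) := a :* (q :* q :* (q :* q) :* (p :* p)))
           refl (V² (σ (u n))) q p ⟩
    V² (σ (u n)) * (q⁴ * (p * p))
      ≈⟨ *-congˡ (*-congˡ (q⁸^ n)) ⟨
    V² (σ (u n)) * (q⁴ * q⁸ ^ n)
      ≈⟨ *-congˡ (trans (V²-* q ((q * q) ^ n)) (*-cong V²-q (begin
           V² ((q * q) ^ n)   ≈⟨ trans (V-cong (V-^ (q * q) n)) (V-^ (V (q * q)) n) ⟩
           V² (q * q) ^ n     ≈⟨ ^-congˡ n (trans (V²-* q q) (*-cong V²-q V²-q)) ⟩
           q⁸ ^ n             ∎))) ⟨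
    V² (σ (u n)) * V² (q * (q * q) ^ n)
      ≈⟨ V²-* (σ (u n)) (q * (q * q) ^ n) ⟨
    V² (σ (u n) * (q * (q * q) ^ n))
      ≈⟨ V-cong (V-cong (σ-u n)) ⟨
    V² (σ (u (suc n))) ∎
    where
    p : Series
    p = (q * q) ^ (n ℕ.* 2)

  -- An odd square is one more than eight times a triangular number: (2n + 1)² = 8 · n(n + 1)/2 + 1.
  u-odd : ∀ n → u (suc (n ℕ.* 2)) ≈ - (q * V³ (t n))
  u-odd zero    = begin
    1# * - (q * 1#)  ≈⟨ solve 1 (λ q → :1 :* (:- (q :* :1)) := :- (q :* :1)) refl q ⟩
    - (q * 1#)       ≈⟨ -‿cong (*-congˡ (trans (V-cong (trans (V-cong V-1) V-1)) V-1)) ⟨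
    - (q * V³ 1#)    ∎
  u-odd (suc n) = begin
    u (suc (n ℕ.* 2)) * - (q * (q * q * p)) * - (q * (q * q * (q * q * p)))
      ≈⟨ *-congʳ (*-congʳ (u-odd n)) ⟩
    - (q * V³ (t n)) * - (q * (q * q * p)) * - (q * (q * q * (q * q * p)))
      ≈⟨ solve 3 (λ q a p → (:- (q :* a)) :* (:- (q :* (q :* q :* p))) :* (:- (q :* (q :* q :* (q :* q :* p)))) :=
           :- (q :* (a :* (q :* q :* (q :* q) :* (q :* q :* (q :* q)) :* (p :* p))))) refl q (V³ (t n)) p ⟩
    - (q * (V³ (t n) * (q⁸ * (p * p))))
      ≈⟨ -‿cong (*-congˡ (*-congˡ (*-congˡ (q⁸^ n)))) ⟨
    - (q * (V³ (t n) * q⁸ ^ suc n))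
      ≈⟨ -‿cong (*-congˡ (*-congˡ (begin
           V³ (q ^ suc n)   ≈⟨ V-cong (trans (V-cong (V-^ q (suc n))) (V-^ (V q) (suc n))) ⟩
           V (V² q ^ suc n) ≈⟨ V-^ (V² q) (suc n) ⟩
           V³ q ^ suc n     ≈⟨ ^-congˡ (suc n) (trans (V-cong V²-q) V-q⁴) ⟩
           q⁸ ^ suc n       ∎))) ⟨
    - (q * (V³ (t n) * V³ (q ^ suc n)))
      ≈⟨ -‿cong (*-congˡ (trans (V-cong (V²-* (t n) (q ^ suc n))) (V-* (V² (t n)) (V² (q ^ suc n))))) ⟨
    - (q * V³ (t (suc n))) ∎
    where
    p : Series
    p = (q * q) ^ (n ℕ.* 2)

  σ-⟨⟩ : ∀ k → σ ⟨ k ⟩ ≈ ⟨ k ⟩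
  σ-⟨⟩ k = negate-constant ι.⟦ k ⟧

  V-⟨⟩ : ∀ k → V ⟨ k ⟩ ≈ ⟨ k ⟩
  V-⟨⟩ k = spread-constant 1 ι.⟦ k ⟧

  -- Stopping at the odd index 2n + 1 completes both halves: the even indices up to 2n give a
  -- partial sum of φ(q⁴), the odd ones up to 2n + 1 a partial sum of ψ(q⁸).
  Θ-dissection : ∀ n → Θ< (suc (n ℕ.* 2)) ≈ V² (σ (Θ< n)) - ⟨ + 2 ⟩ * (q * V³ (ψ< n))
  Θ-dissection zero    = begin
    1# + ⟨ + 2 ⟩ * u 1                             ≈⟨ +-cong (u-even 0) (*-congˡ (u-odd 0)) ⟩
    V² (σ 1#) + ⟨ + 2 ⟩ * - (q * V³ 1#)
      ≈⟨ solve 3 (λ a q b → a :+ con (+ 2) :* (:- (q :* b)) := a :- con (+ 2) :* (q :* b))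
           refl (V² (σ 1#)) q (V³ 1#) ⟩
    V² (σ 1#) - ⟨ + 2 ⟩ * (q * V³ 1#)              ∎
  Θ-dissection (suc n) = begin
    Θ< (suc (n ℕ.* 2)) + ⟨ + 2 ⟩ * u (suc n ℕ.* 2) + ⟨ + 2 ⟩ * u (suc (suc n ℕ.* 2))
      ≈⟨ +-cong (+-cong (Θ-dissection n) (*-congˡ (u-even (suc n)))) (*-congˡ (u-odd (suc n))) ⟩
    V² (σ (Θ< n)) - ⟨ + 2 ⟩ * (q * V³ (ψ< n)) + ⟨ + 2 ⟩ * V² (σ (u (suc n))) + ⟨ + 2 ⟩ * - (q * V³ (t (suc n)))
      ≈⟨ solve 5 (λ a q b c d → a :- con (+ 2) :* (q :* b) :+ con (+ 2) :* c :+ con (+ 2) :* (:- (q :* d)) :=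
           a :+ con (+ 2) :* c :- con (+ 2) :* (q :* (b :+ d)))
           refl (V² (σ (Θ< n))) q (V³ (ψ< n)) (V² (σ (u (suc n)))) (V³ (t (suc n))) ⟩
    V² (σ (Θ< n)) + ⟨ + 2 ⟩ * V² (σ (u (suc n))) - ⟨ + 2 ⟩ * (q * (V³ (ψ< n) + V³ (t (suc n))))
      ≈⟨ +-cong (begin
           V² (σ (Θ< n + ⟨ + 2 ⟩ * u (suc n)))
             ≈⟨ V-cong (V-cong (trans (negate-⊕ (Θ< n) (⟨ + 2 ⟩ * u (suc n)))
                  (+-congˡ (trans (negate-⊛ ⟨ + 2 ⟩ (u (suc n))) (*-congʳ (σ-⟨⟩ (+ 2))))))) ⟩
           V² (σ (Θ< n) + ⟨ + 2 ⟩ * σ (u (suc n)))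
             ≈⟨ trans (V²-+ (σ (Θ< n)) (⟨ + 2 ⟩ * σ (u (suc n)))) (+-congˡ (trans (V²-* ⟨ + 2 ⟩ (σ (u (suc n))))
                  (*-congʳ (trans (V-cong (V-⟨⟩ (+ 2))) (V-⟨⟩ (+ 2)))))) ⟩
           V² (σ (Θ< n)) + ⟨ + 2 ⟩ * V² (σ (u (suc n))) ∎)
         (-‿cong (*-congˡ (*-congˡ (trans (V-cong (V²-+ (ψ< n) (t (suc n)))) (V-+ (V² (ψ< n)) (V² (t (suc n)))))))) ⟨
    V² (σ (Θ< (suc n))) - ⟨ + 2 ⟩ * (q * V³ (ψ< (suc n))) ∎

  T-dissection : T ≈ V² (σ T) - ⟨ + 2 ⟩ * (q * V³ Ψ)
  T-dissection = ⟶-unique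
    (⟶-cong Θ-dissection (⟶-subsequence (λ n → suc (n ℕ.* 2)) (λ n → ℕ.m≤n⇒m≤1+n (n≤n*2 n)) Θ⟶))
    (⟶-⊕ (⟶-spread 1 (⟶-spread 1 (⟶-negate Θ⟶)))
         (⟶-⊖ (⟶-⊛ (⟶-const ⟨ + 2 ⟩) (⟶-⊛ (⟶-const q) (⟶-spread 1 (⟶-spread 1 (⟶-spread 1 ψ⟶)))))))

  σT-dissection : σ T ≈ V (V (σ T)) + q * V (⟨ + 2 ⟩ * V² Ψ)
  σT-dissection = begin
    σ T
      ≈⟨ negate-cong T-dissection ⟩
    σ (V² (σ T) - ⟨ + 2 ⟩ * (q * V³ Ψ))
      ≈⟨ negate-⊕ (V² (σ T)) (- (⟨ + 2 ⟩ * (q * V³ Ψ))) ⟩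
    σ (V² (σ T)) + σ (- (⟨ + 2 ⟩ * (q * V³ Ψ)))
      ≈⟨ +-cong (negate-spread (V (σ T))) (begin
           σ (- (⟨ + 2 ⟩ * (q * V³ Ψ)))      ≈⟨ negate-⊖ (⟨ + 2 ⟩ * (q * V³ Ψ)) ⟩
           - σ (⟨ + 2 ⟩ * (q * V³ Ψ))        ≈⟨ -‿cong (trans (negate-⊛ ⟨ + 2 ⟩ (q * V³ Ψ))
                                                 (*-cong (σ-⟨⟩ (+ 2)) (trans (negate-⊛ q (V³ Ψ)) (*-cong negate-q (negate-spread (V² Ψ)))))) ⟩
           - (⟨ + 2 ⟩ * (- q * V³ Ψ))
             ≈⟨ solve 2 (λ q a → :- (con (+ 2) :* ((:- q) :* a)) := q :* (con (+ 2) :* a)) refl q (V³ Ψ) ⟩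
           q * (⟨ + 2 ⟩ * V³ Ψ)              ≈⟨ *-congˡ (trans (V-* ⟨ + 2 ⟩ (V² Ψ)) (*-congʳ (V-⟨⟩ (+ 2)))) ⟨
           q * V (⟨ + 2 ⟩ * V² Ψ)            ∎) ⟩
    V (V (σ T)) + q * V (⟨ + 2 ⟩ * V² Ψ) ∎

  V-injective : ∀ {A B} → V A ≈ V B → A ≈ B
  V-injective {A} {B} VA≈VB = trans (sym (sect A)) (trans even≈ (sect B))
    where
    sect : ∀ A → section 2 0 (V A * 1#) ≈ A
    sect A = trans (section-spread-⊛ 1 z≤n 1# A) (trans (*-congˡ one) (*-identityʳ A))
      where
      one : section 2 0 1# ≈ 1#
      one .at zero    = K.refl
      one .at (suc n) = K.refl
    even≈ : section 2 0 (V A * 1#) ≈ section 2 0 (V B * 1#)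
    even≈ .at n = *-congʳ {1#} VA≈VB .at (n ℕ.* 2)

  -- At q² in place of q the left side is φ(q)φ(-q), which the two dissections write as a difference
  -- of squares. The result contains only even powers, so the substitution can be undone by
  -- `V-injective`.
  T²-dissection : T * T ≈ V (σ T) * V (σ T) - ⟨ + 4 ⟩ * (q * (V² Ψ * V² Ψ))
  T²-dissection = V-injective (begin
    V (T * T)
      ≈⟨ TσT≈VT² ⟨
    T * σ T
      ≈⟨ *-cong T-dissection σT-dissection ⟩
    (X - ⟨ + 2 ⟩ * (q * Y)) * (X + q * V (⟨ + 2 ⟩ * V² Ψ))
      ≈⟨ *-congˡ (+-congˡ (*-congˡ (trans (V-* ⟨ + 2 ⟩ (V² Ψ)) (*-congʳ (V-⟨⟩ (+ 2)))))) ⟩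
    (X - ⟨ + 2 ⟩ * (q * Y)) * (X + q * (⟨ + 2 ⟩ * Y))
      ≈⟨ solve 3 (λ x q y → (x :- con (+ 2) :* (q :* y)) :* (x :+ q :* (con (+ 2) :* y)) :=
           x :* x :- con (+ 4) :* (q :* q :* (y :* y))) refl X q Y ⟩
    X * X - ⟨ + 4 ⟩ * (q * q * (Y * Y))
      ≈⟨ +-cong (V-* (V (σ T)) (V (σ T))) (-‿cong (begin
           V (⟨ + 4 ⟩ * (q * (V² Ψ * V² Ψ)))
             ≈⟨ trans (V-* ⟨ + 4 ⟩ (q * (V² Ψ * V² Ψ))) (*-cong (V-⟨⟩ (+ 4)) (V-* q (V² Ψ * V² Ψ))) ⟩
           ⟨ + 4 ⟩ * (V q * V (V² Ψ * V² Ψ))      ≈⟨ *-congˡ (*-cong V-q (V-* (V² Ψ) (V² Ψ))) ⟩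
           ⟨ + 4 ⟩ * (q * q * (Y * Y))            ∎)) ⟨
    V (V (σ T) * V (σ T)) - V (⟨ + 4 ⟩ * (q * (V² Ψ * V² Ψ)))
      ≈⟨ trans (V-+ (V (σ T) * V (σ T)) (- (⟨ + 4 ⟩ * (q * (V² Ψ * V² Ψ))))) (+-congˡ (V-neg (⟨ + 4 ⟩ * (q * (V² Ψ * V² Ψ))))) ⟨
    V (V (σ T) * V (σ T) - ⟨ + 4 ⟩ * (q * (V² Ψ * V² Ψ))) ∎)
    where
    X Y : Series
    X = V² (σ T)
    Y = V³ Ψ

  σT²-dissection : σ T * σ T ≈ V (σ T * σ T) + q * V (⟨ + 4 ⟩ * (V Ψ * V Ψ))
  σT²-dissection = begin
    σ T * σ T
      ≈⟨ negate-⊛ T T ⟨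
    σ (T * T)
      ≈⟨ negate-cong T²-dissection ⟩
    σ (V (σ T) * V (σ T) - ⟨ + 4 ⟩ * (q * (V² Ψ * V² Ψ)))
      ≈⟨ trans (negate-⊕ (V (σ T) * V (σ T)) (- (⟨ + 4 ⟩ * (q * (V² Ψ * V² Ψ)))))
           (+-congˡ (negate-⊖ (⟨ + 4 ⟩ * (q * (V² Ψ * V² Ψ))))) ⟩
    σ (V (σ T) * V (σ T)) - σ (⟨ + 4 ⟩ * (q * (V² Ψ * V² Ψ)))
      ≈⟨ +-cong (σ-even (σ T) (σ T)) (-‿cong (trans (negate-⊛ ⟨ + 4 ⟩ (q * (V² Ψ * V² Ψ)))
           (*-cong (σ-⟨⟩ (+ 4)) (trans (negate-⊛ q (V² Ψ * V² Ψ)) (*-cong negate-q (σ-even (V Ψ) (V Ψ))))))) ⟩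
    V (σ T * σ T) - ⟨ + 4 ⟩ * (- q * V (V Ψ * V Ψ))
      ≈⟨ solve 3 (λ a q b → a :- con (+ 4) :* ((:- q) :* b) := a :+ q :* (con (+ 4) :* b))
           refl (V (σ T * σ T)) q (V (V Ψ * V Ψ)) ⟩
    V (σ T * σ T) + q * (⟨ + 4 ⟩ * V (V Ψ * V Ψ))
      ≈⟨ +-congˡ (*-congˡ (trans (V-* ⟨ + 4 ⟩ (V Ψ * V Ψ)) (*-congʳ (V-⟨⟩ (+ 4))))) ⟨
    V (σ T * σ T) + q * V (⟨ + 4 ⟩ * (V Ψ * V Ψ)) ∎
    where
    σ-even : ∀ A B → σ (V A * V B) ≈ V (A * B)
    σ-even A B = trans (negate-cong (sym (V-* A B))) (negate-spread (A * B))

  -- Extraction of odd-indexed coefficients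

  odd : Series → Series
  odd = section 2 1

  -- One extraction without division: factors in q² pass through, `V Y` has no odd coefficients, and
  -- `q * V Z` contributes exactly Z.
  odd-part : ∀ {A B X Y Z} → A * V B ≈ V X * (V Y + q * V Z) → odd A * B ≈ X * Z
  odd-part {A} {B} {X} {Y} {Z} AVB≈ = begin
    odd A * B                               ≈⟨ *-comm (odd A) B ⟩
    B * odd A                               ≈⟨ section-spread-⊛ 1 (s≤s z≤n) A B ⟨
    odd (V B * A)                           ≈⟨ odd-cong (trans (*-comm (V B) A) AVB≈) ⟩
    odd (V X * (V Y + q * V Z))             ≈⟨ section-spread-⊛ 1 (s≤s z≤n) (V Y + q * V Z) X ⟩
    X * odd (V Y + q * V Z)                 ≈⟨ *-congˡ (odd-+ (V Y) (q * V Z)) ⟩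
    X * (odd (V Y) + odd (q * V Z))         ≈⟨ *-congˡ (+-cong
      (trans (odd-cong (sym (*-identityʳ (V Y)))) (trans (section-spread-⊛ 1 (s≤s z≤n) 1# Y) (trans (*-congˡ odd-1) (zeroʳ Y))))
      (trans (odd-cong (*-comm q (V Z))) (trans (section-spread-⊛ 1 (s≤s z≤n) q Z) (trans (*-congˡ odd-q) (*-identityʳ Z))))) ⟩
    X * (0# + Z)                            ≈⟨ *-congˡ (+-identityˡ Z) ⟩
    X * Z                                   ∎
    where
    odd-cong : ∀ {A B} → A ≈ B → odd A ≈ odd B
    odd-cong A≈B .at n = A≈B .at (suc (n ℕ.* 2))
    odd-+ : ∀ A B → odd (A + B) ≈ odd A + odd B
    odd-+ A B .at n = K.refl
    odd-1 : odd 1# ≈ 0#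
    odd-1 .at n = K.refl
    odd-q : odd q ≈ 1#
    odd-q .at zero    = K.refl
    odd-q .at (suc n) = K.refl

  -- Three extractions reach the indices 2(2(2n + 1) + 1) + 1 = 8n + 7. They contribute the factors
  -- 2 from φ, 4 from φ² and 8 from φ⁴, hence the constant 64.
  odd³ : ∀ {G} → G * (f * f) ≈ F * V (V F) → odd (odd (odd G)) * oddEuler ^ 22 ≈ ⟨ + 64 ⟩
  odd³ {G} Gf²≈ = ⊛-cancelʳ {F ^ 8} (F^n₀≈1 8) (begin
    G₃ * oddEuler ^ 22 * F ^ 8
      -- The eighth power of `T` absorbs 16 of the 22 factors `oddEuler`. The other six and the one
      -- inside `f` cancel against the seven factors `distinct` of `Ψ ^ 7`.
      ≈⟨ solve 3 (λ g o F → g :* o :^ 22 :* F :^ 8 := g :* (o :* o :* F) :^ 8 :* o :^ 6) refl G₃ oddEuler F ⟩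
    G₃ * (oddEuler * oddEuler * F) ^ 8 * oddEuler ^ 6
      ≈⟨ *-congʳ (*-congˡ (^-congˡ 8 T≈o²F)) ⟨
    G₃ * T ^ 8 * oddEuler ^ 6
      ≈⟨ *-congʳ G₃T⁸≈ ⟩
    ⟨ + 64 ⟩ * f * Ψ ^ 7 * oddEuler ^ 6
      ≈⟨ *-congʳ (*-cong (*-congˡ f≈oF) (^-congˡ 7 Ψ≈dF)) ⟩
    ⟨ + 64 ⟩ * (oddEuler * F) * (distinct * F) ^ 7 * oddEuler ^ 6
      ≈⟨ solve 3 (λ o d F → con (+ 64) :* (o :* F) :* (d :* F) :^ 7 :* o :^ 6 := con (+ 64) :* (o :* d) :^ 7 :* F :^ 8)
           refl oddEuler distinct F ⟩
    ⟨ + 64 ⟩ * (oddEuler * distinct) ^ 7 * F ^ 8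
      ≈⟨ *-congʳ (trans (*-congˡ (trans (^-congˡ 7 od≈1) (solve 0 (:1 :^ 7 := :1) refl))) (*-identityʳ ⟨ + 64 ⟩)) ⟩
    ⟨ + 64 ⟩ * F ^ 8 ∎)
    where
    F^n₀≈1 : ∀ n → (F ^ n) 0 K.≈ K.1#
    F^n₀≈1 zero    = K.refl
    F^n₀≈1 (suc n) = K.trans (K.*-identityˡ _) (F^n₀≈1 n)
    G₁ G₂ G₃ : Series
    G₁ = odd G
    G₂ = odd G₁
    G₃ = odd G₂

    GT≈ : G * T ≈ V (V F)
    GT≈ = ⊛-cancelʳ {F} K.refl (begin
      G * T * F                               ≈⟨ *-congʳ (*-congˡ T≈o²F) ⟩
      G * (oddEuler * oddEuler * F) * F
        ≈⟨ solve 3 (λ g o F → g :* (o :* o :* F) :* F := g :* (o :* F :* (o :* F))) refl G oddEuler F ⟩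
      G * (oddEuler * F * (oddEuler * F))     ≈⟨ *-congˡ (*-cong f≈oF f≈oF) ⟨
      G * (f * f)                             ≈⟨ Gf²≈ ⟩
      F * V (V F)                             ≈⟨ *-comm F (V (V F)) ⟩
      V (V F) * F                             ∎)

    -- Multiplying `GT≈` by `σ T` leaves `G` times a series in q² on the left, while on the right
    -- the dissection of `σ T` separates the parities. The next two extractions repeat this with the
    -- square and the fourth power of `σ T`.
    G₁T²≈ : G₁ * (T * T) ≈ V F * (⟨ + 2 ⟩ * V² Ψ)
    G₁T²≈ = odd-part (begin
      G * V (T * T)      ≈⟨ *-congˡ TσT≈VT² ⟨
      G * (T * σ T)      ≈⟨ *-assoc G T (σ T) ⟨
      G * T * σ T        ≈⟨ *-cong GT≈ σT-dissection ⟩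
      V (V F) * (V (V (σ T)) + q * V (⟨ + 2 ⟩ * V² Ψ)) ∎)

    VT⁴≈ : V (T * T * (T * T)) ≈ T * T * (σ T * σ T)
    VT⁴≈ = begin
      V (T * T * (T * T))      ≈⟨ V-* (T * T) (T * T) ⟩
      V (T * T) * V (T * T)    ≈⟨ *-cong TσT≈VT² TσT≈VT² ⟨
      T * σ T * (T * σ T)      ≈⟨ solve 2 (λ a b → a :* b :* (a :* b) := a :* a :* (b :* b)) refl T (σ T) ⟩
      T * T * (σ T * σ T)      ∎

    G₂T⁴≈ : G₂ * (T * T * (T * T)) ≈ F * (⟨ + 2 ⟩ * V Ψ) * (⟨ + 4 ⟩ * (V Ψ * V Ψ))
    G₂T⁴≈ = odd-part (begin
      G₁ * V (T * T * (T * T))                      ≈⟨ *-congˡ VT⁴≈ ⟩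
      G₁ * (T * T * (σ T * σ T))                    ≈⟨ *-assoc G₁ (T * T) (σ T * σ T) ⟨
      G₁ * (T * T) * (σ T * σ T)                    ≈⟨ *-cong G₁T²≈ σT²-dissection ⟩
      V F * (⟨ + 2 ⟩ * V² Ψ) * (V (σ T * σ T) + q * V (⟨ + 4 ⟩ * (V Ψ * V Ψ)))
        ≈⟨ *-congʳ (trans (V-* F (⟨ + 2 ⟩ * V Ψ)) (*-congˡ (trans (V-* ⟨ + 2 ⟩ (V Ψ)) (*-congʳ (V-⟨⟩ (+ 2)))))) ⟨
      V (F * (⟨ + 2 ⟩ * V Ψ)) * (V (σ T * σ T) + q * V (⟨ + 4 ⟩ * (V Ψ * V Ψ))) ∎)

    X Y : Series
    X = σ T * σ T
    Y = ⟨ + 4 ⟩ * (V Ψ * V Ψ)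

    -- Squaring the dissection of φ² gives an odd part equal to the cross term; the square of the
    -- old odd part carries q² and joins the even part.
    σT⁴-dissection : X * X ≈ V (X * X + q * (Y * Y)) + q * V (⟨ + 2 ⟩ * (X * Y))
    σT⁴-dissection = begin
      X * X
        ≈⟨ *-cong σT²-dissection σT²-dissection ⟩
      (V X + q * V Y) * (V X + q * V Y)
        ≈⟨ solve 3 (λ a q b → (a :+ q :* b) :* (a :+ q :* b) := a :* a :+ q :* q :* (b :* b) :+ q :* (con (+ 2) :* (a :* b)))
             refl (V X) q (V Y) ⟩
      V X * V X + q * q * (V Y * V Y) + q * (⟨ + 2 ⟩ * (V X * V Y))
        ≈⟨ +-cong (trans (V-+ (X * X) (q * (Y * Y))) (+-cong (V-* X X) (trans (V-* q (Y * Y)) (*-cong V-q (V-* Y Y)))))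
             (*-congˡ (trans (V-* ⟨ + 2 ⟩ (X * Y)) (*-cong (V-⟨⟩ (+ 2)) (V-* X Y)))) ⟨
      V (X * X + q * (Y * Y)) + q * V (⟨ + 2 ⟩ * (X * Y)) ∎

    -- The right side of `G₂T⁴≈` is a series in q²; `C` is that series with q² replaced by q.
    C : Series
    C = ⟨ + 8 ⟩ * f * Ψ ^ 3

    VC≈ : V C ≈ F * (⟨ + 2 ⟩ * V Ψ) * (⟨ + 4 ⟩ * (V Ψ * V Ψ))
    VC≈ = begin
      V (⟨ + 8 ⟩ * f * Ψ ^ 3)      ≈⟨ trans (V-* (⟨ + 8 ⟩ * f) (Ψ ^ 3)) (*-cong (V-* ⟨ + 8 ⟩ f) (V-^ Ψ 3)) ⟩
      V ⟨ + 8 ⟩ * V f * V Ψ ^ 3    ≈⟨ *-congʳ (*-cong (V-⟨⟩ (+ 8)) (sym F≈Vf)) ⟩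
      ⟨ + 8 ⟩ * F * V Ψ ^ 3
        ≈⟨ solve 2 (λ F ψ → con (+ 8) :* F :* ψ :^ 3 := F :* (con (+ 2) :* ψ) :* (con (+ 4) :* (ψ :* ψ)))
             refl F (V Ψ) ⟩
      F * (⟨ + 2 ⟩ * V Ψ) * (⟨ + 4 ⟩ * (V Ψ * V Ψ)) ∎

    G₃T⁸≈ : G₃ * T ^ 8 ≈ ⟨ + 64 ⟩ * f * Ψ ^ 7
    G₃T⁸≈ = begin
      G₃ * T ^ 8
        ≈⟨ solve 2 (λ g t → g :* t :^ 8 := g :* (t :* t :* (t :* t) :* (t :* t :* (t :* t)))) refl G₃ T ⟩
      G₃ * (T * T * (T * T) * (T * T * (T * T)))
        ≈⟨ odd-part (begin
             G₂ * V (T * T * (T * T) * (T * T * (T * T)))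
               ≈⟨ *-congˡ (trans (V-* (T * T * (T * T)) (T * T * (T * T))) (*-cong VT⁴≈ VT⁴≈)) ⟩
             G₂ * (T * T * X * (T * T * X))
               ≈⟨ solve 3 (λ g t a → g :* (t :* t :* a :* (t :* t :* a)) := g :* (t :* t :* (t :* t)) :* (a :* a))
                    refl G₂ T X ⟩
             G₂ * (T * T * (T * T)) * (X * X)
               ≈⟨ *-cong (trans G₂T⁴≈ (sym VC≈)) σT⁴-dissection ⟩
             V C * (V (X * X + q * (Y * Y)) + q * V (⟨ + 2 ⟩ * (X * Y))) ∎) ⟩
      C * (⟨ + 2 ⟩ * (X * Y))
        ≈⟨ solve 4 (λ f ψ t w → con (+ 8) :* f :* ψ :^ 3 :* (con (+ 2) :* (t :* t :* (con (+ 4) :* (w :* w)))) :=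
             con (+ 64) :* f :* (ψ :^ 3 :* (t :* w :* (t :* w)))) refl f Ψ (σ T) (V Ψ) ⟩
      ⟨ + 64 ⟩ * f * (Ψ ^ 3 * (σ T * V Ψ * (σ T * V Ψ)))
        -- The remaining φ(q)² and ψ(q²)² pair off into ψ(q)⁴, which leaves only `f` and a power of
        -- `Ψ`.
        ≈⟨ *-congˡ (*-congˡ (*-cong Ψ²≈σTVΨ Ψ²≈σTVΨ)) ⟨
      ⟨ + 64 ⟩ * f * (Ψ ^ 3 * (Ψ * Ψ * (Ψ * Ψ)))
        ≈⟨ solve 2 (λ f ψ → con (+ 64) :* f :* (ψ :^ 3 :* (ψ :* ψ :* (ψ :* ψ))) := con (+ 64) :* f :* ψ :^ 7)
             refl f Ψ ⟩
      ⟨ + 64 ⟩ * f * Ψ ^ 7 ∎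

  -- Frobenius

  module _ (11≈0 : ι.⟦ + 11 ⟧ K.≈ K.0#) where

    V₁₁ : Series → Series
    V₁₁ = spread 10 0

    frobenius-complement : ∀ x → (1# - x) ^ 11 ≈ 1# - x ^ 11
    frobenius-complement x = begin
      (1# - x) ^ 11
        ≈⟨ solve 1 (λ x → (:1 :- x) :^ 11 := (:1 :- x :^ 11) :+ con (+ 11) :* (remainder x)) refl x ⟩
      (1# - x ^ 11) + ⟨ + 11 ⟩ * _
        ≈⟨ +-congˡ (trans (*-congʳ (trans (constant-cong 11≈0) constant-0)) (zeroˡ _)) ⟩
      (1# - x ^ 11) + 0#
        ≈⟨ +-identityʳ _ ⟩
      1# - x ^ 11 ∎
      where
      -- The coefficients are the signed binomial coefficients C(11, i)/11 for i from 1 to 10.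
      remainder : Polynomial 1 → Polynomial 1
      remainder x = (:- x) :+ con (+ 5) :* x :^ 2 :- con (+ 15) :* x :^ 3 :+ con (+ 30) :* x :^ 4
        :- con (+ 42) :* x :^ 5 :+ con (+ 42) :* x :^ 6 :- con (+ 30) :* x :^ 7 :+ con (+ 15) :* x :^ 8
        :- con (+ 5) :* x :^ 9 :+ x :^ 10

    V₁₁-1 : V₁₁ 1# ≈ 1#
    V₁₁-1 = spread-constant 10 K.1#

    1^11 : 1# ^ 11 ≈ 1#
    1^11 = solve 0 (:1 :^ 11 := :1) refl

    frobenius-* : ∀ {A B} → V₁₁ A ≈ A ^ 11 → V₁₁ B ≈ B ^ 11 → V₁₁ (A * B) ≈ (A * B) ^ 11
    frobenius-* {A} {B} VA VB = trans (sym (spread-⊛ 10 0 A B)) (trans (*-cong VA VB) (sym (^-distrib-* A B 11)))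

    frobenius-^ : ∀ {A} n → V₁₁ A ≈ A ^ 11 → V₁₁ (A ^ n) ≈ (A ^ n) ^ 11
    frobenius-^ zero    VA = trans V₁₁-1 (sym 1^11)
    frobenius-^ (suc n) VA = frobenius-* VA (frobenius-^ n VA)

    -- Frobenius is checked on the factors 1 - x, with x a power of q, and carried through finite
    -- products to the limit.
    frobenius-o : V₁₁ oddEuler ≈ oddEuler ^ 11
    frobenius-o = ⟶-unique (⟶-spread 10 o⟶) (⟶-cong (λ m → sym (finite m)) (⟶-^ 11))
      where
      ⟶-^ : ∀ n → (λ m → ∏< m o ^ n) ⟶ oddEuler ^ n
      ⟶-^ zero    = ⟶-const 1#
      ⟶-^ (suc n) = ⟶-⊛ o⟶ (⟶-^ n)

      factor : ∀ j → V₁₁ (o j) ≈ o j ^ 11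
      factor j = begin
        V₁₁ (1# - x)             ≈⟨ spread-⊕ 10 0 1# (- x) ⟩
        V₁₁ 1# + V₁₁ (- x)       ≈⟨ +-cong V₁₁-1 (spread-⊖ 10 0 x) ⟩
        1# - V₁₁ x
          ≈⟨ +-congˡ (-‿cong (frobenius-* (spread-q 10) (frobenius-^ j (frobenius-* (spread-q 10) (spread-q 10))))) ⟩
        1# - x ^ 11              ≈⟨ frobenius-complement x ⟨
        (1# - x) ^ 11            ∎
        where
        x : Series
        x = q * (q * q) ^ j

      finite : ∀ m → V₁₁ (∏< m o) ≈ ∏< m o ^ 11
      finite zero    = trans V₁₁-1 (sym 1^11)
      finite (suc m) = frobenius-* (finite m) (factor m)

    -- Multiplied by a series in q^11 with constant term 1, the extracted series is constant. A
    -- section at a nonzero residue therefore vanishes after multiplication by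
    -- `oddEuler * oddEuler`, and this factor can be cancelled.
    section-odd³-vanishes : ∀ {G} → G * (f * f) ≈ F * V (V F) → ∀ {r} → r < 10 →
                            section 11 (suc r) (odd (odd (odd G))) ≈ 0#
    section-odd³-vanishes {G} Gf²≈ {r} r<10 = ⊛-cancelʳ-0 {oddEuler * oddEuler} (K.*-identityˡ K.1#) (begin
      section 11 (suc r) H * (oddEuler * oddEuler)
        ≈⟨ *-comm (section 11 (suc r) H) (oddEuler * oddEuler) ⟩
      oddEuler * oddEuler * section 11 (suc r) H          ≈⟨ section-spread-⊛ 10 r<10 H (oddEuler * oddEuler) ⟨
      section 11 (suc r) (V₁₁ (oddEuler * oddEuler) * H)  ≈⟨ vanishing ⟩
      0#                                                  ∎)
      where
      H : Series
      H = odd (odd (odd G))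
      V₁₁o²H≈64 : V₁₁ (oddEuler * oddEuler) * H ≈ ⟨ + 64 ⟩
      V₁₁o²H≈64 = begin
        V₁₁ (oddEuler * oddEuler) * H      ≈⟨ *-congʳ (frobenius-* frobenius-o frobenius-o) ⟩
        (oddEuler * oddEuler) ^ 11 * H
          ≈⟨ solve 2 (λ o h → (o :* o) :^ 11 :* h := h :* o :^ 22) refl oddEuler H ⟩
        H * oddEuler ^ 22                  ≈⟨ odd³ Gf²≈ ⟩
        ⟨ + 64 ⟩                           ∎
      vanishing : section 11 (suc r) (V₁₁ (oddEuler * oddEuler) * H) ≈ 0#
      -- The index is positive, and there the constant series 64 is zero by definition.
      vanishing .at n = V₁₁o²H≈64 .at (suc (r ℕ.+ n ℕ.* 11))

  -- Generating functions of regular partitions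

  gf : (ℕ → ℕ) → Series
  gf a n = ι.⟦ + a n ⟧

  gf-cong : ∀ {a b} → (∀ n → a n ≡ b n) → gf a ≈ gf b
  gf-cong a≡b .at n = K.reflexive (≡.cong (λ x → ι.⟦ + x ⟧) (a≡b n))

  ι-+ : ∀ m n → ι.⟦ + (m ℕ.+ n) ⟧ K.≈ ι.⟦ + m ⟧ K.+ ι.⟦ + n ⟧
  ι-+ m n = K.trans (K.reflexive (≡.cong ι.⟦_⟧ (ℤ.pos-+ m n))) (ι.+-homo (+ m) (+ n))

  ι-* : ∀ m n → ι.⟦ + (m ℕ.* n) ⟧ K.≈ ι.⟦ + m ⟧ K.* ι.⟦ + n ⟧
  ι-* m n = K.trans (K.reflexive (≡.cong ι.⟦_⟧ (ℤ.pos-* m n))) (ι.*-homo (+ m) (+ n))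

  gf-convolution : ∀ {a b} {A : Set a} {B : Set b} (g : ℕ → List A) (h : ℕ → List B) →
                   gf (λ n → length (convolution g h n)) ≈ gf (length ∘ g) * gf (length ∘ h)
  gf-convolution g h .at zero =
    K.trans (K.reflexive (≡.cong (λ x → ι.⟦ + x ⟧) (length-cartesianProduct (g 0) (h 0)))) (ι-* _ _)
  gf-convolution g h .at (suc n) = K.trans
    (K.reflexive (≡.cong (λ x → ι.⟦ + x ⟧) (≡.trans (length-++ (cartesianProduct (g 0) (h (suc n))))
      (≡.cong (ℕ._+ length (convolution (g ∘ suc) h n)) (length-cartesianProduct (g 0) (h (suc n)))))))
    (K.trans (ι-+ _ _) (K.+-cong (ι-* _ _) (gf-convolution (g ∘ suc) h .at n)))

  boundedGF : (l k : ℕ) → Series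
  boundedGF l k = gf (count l k)

  regularGF : ℕ → Series
  regularGF l = gf (λ n → count l n n)

  boundedGF⟶ : ∀ l → boundedGF l ⟶ regularGF l
  boundedGF⟶ l i≤m = K.reflexive (≡.cong (λ x → ι.⟦ + x ⟧) (count-stable l i≤m))

  boundedGF-zero : ∀ l → boundedGF l 0 ≈ 1#
  boundedGF-zero l .at zero    = ι.1-homo
  boundedGF-zero l .at (suc n) = K.trans (K.reflexive (≡.cong (λ x → ι.⟦ + x ⟧) (count-zero-suc l n))) ι.0-homo

  boundedGF-split : ∀ l {k} → ¬ l ∣ suc k →
                    boundedGF l (suc k) ≈ boundedGF l k + q ^ suc k * boundedGF l (suc k)
  boundedGF-split l {k} l∤1+k .at n with n ℕ.<? suc k
  ... | yes n<1+k = K.trans (K.reflexive (≡.cong (λ x → ι.⟦ + x ⟧) (count-small l n<1+k)))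
                      (K.trans (K.sym (K.+-identityʳ _)) (K.+-congˡ (K.sym (q^-⊛-< (suc k) _ n<1+k))))
  ... | no n≮1+k with ℕ.m≤n⇒∃[o]m+o≡n (ℕ.≮⇒≥ n≮1+k)
  ...   | m , ≡.refl = K.trans (K.reflexive (≡.cong (λ x → ι.⟦ + x ⟧) (count-split l m l∤1+k)))
                         (K.trans (ι-+ _ _) (K.+-congˡ (K.sym (q^-⊛-+ (suc k) _ m))))

  -- The numerator over the full denominator f₁: a forbidden part keeps its factor so as to cancel
  -- the one in f₁, and an allowed part contributes 1.
  multiples : ℕ → ℕ → Series
  multiples l j with l ∣? suc j
  ... | yes _ = e q j
  ... | no  _ = 1#

  multiples-convergent : ∀ l → Convergent (multiples l)
  multiples-convergent l {j} i≤j with l ∣? suc j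
  ... | yes _ = e-convergent q 1# (sym (*-identityˡ q)) i≤j
  ... | no  _ = K.refl

  boundedGF-euler : ∀ l k → boundedGF l k * ∏< k (e q) ≈ ∏< k (multiples l)
  boundedGF-euler l zero    = trans (*-identityʳ _) (boundedGF-zero l)
  boundedGF-euler l (suc k) with l ∣? suc k
  ... | yes l∣1+k = begin
    boundedGF l (suc k) * (∏< k (e q) * e q k)      ≈⟨ *-congʳ (gf-cong (λ n → count-divisible l n l∣1+k)) ⟩
    boundedGF l k * (∏< k (e q) * e q k)            ≈⟨ *-assoc _ _ _ ⟨
    boundedGF l k * ∏< k (e q) * e q k              ≈⟨ *-congʳ (boundedGF-euler l k) ⟩
    ∏< k (multiples l) * e q k                      ∎
  ... | no l∤1+k = begin
    C′ * (∏< k (e q) * (1# - q ^ suc k))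
      ≈⟨ solve 3 (λ c p x → c :* (p :* (:1 :- x)) := (c :- x :* c) :* p) refl C′ (∏< k (e q)) (q ^ suc k) ⟩
    (C′ - q ^ suc k * C′) * ∏< k (e q)
      ≈⟨ *-congʳ (+-congʳ (boundedGF-split l l∤1+k)) ⟩
    (boundedGF l k + q ^ suc k * C′ - q ^ suc k * C′) * ∏< k (e q)
      ≈⟨ solve 3 (λ c x p → (c :+ x :- x) :* p := c :* p :* :1)
           refl (boundedGF l k) (q ^ suc k * C′) (∏< k (e q)) ⟩
    boundedGF l k * ∏< k (e q) * 1#
      ≈⟨ *-congʳ (boundedGF-euler l k) ⟩
    ∏< k (multiples l) * 1# ∎
    where
    C′ : Series
    C′ = boundedGF l (suc k)

  multiples-divides : ∀ {l j} → l ∣ suc j → multiples l j ≈ e q j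
  multiples-divides {l} {j} l∣1+j with l ∣? suc j
  ... | yes _     = refl
  ... | no  l∤1+j = contradiction l∣1+j l∤1+j

  multiples-¬divides : ∀ {l j} → ¬ l ∣ suc j → multiples l j ≈ 1#
  multiples-¬divides {l} {j} l∤1+j with l ∣? suc j
  ... | yes l∣1+j = contradiction l∣1+j l∤1+j
  ... | no  _     = refl

  module _ (l-1 : ℕ) where
    private
      l = suc l-1

    -- Strictly between two consecutive multiples of l all factors are 1.
    multiples-block : ∀ m {r} → r < l → ∏< (r ℕ.+ m ℕ.* l) (multiples l) ≈ ∏< (m ℕ.* l) (multiples l)
    multiples-block m {zero}  _   = refl
    multiples-block m {suc r} r<l = trans
      (*-cong (multiples-block m (ℕ.<-trans (ℕ.n<1+n r) r<l))
              (multiples-¬divides λ l∣ → >⇒∤ r<l (∣m+n∣m⇒∣n (≡.subst (l ∣_) (ℕ.+-comm (suc r) (m ℕ.* l)) l∣) (n∣m*n m))))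
      (*-identityʳ _)

    multiples-euler : ∀ m → ∏< (m ℕ.* l) (multiples l) ≈ ∏< m (e (q ^ l))
    multiples-euler zero    = refl
    multiples-euler (suc m) = *-cong (trans (multiples-block m (ℕ.n<1+n l-1)) (multiples-euler m))
      (trans (multiples-divides {l} {l-1 ℕ.+ m ℕ.* l} (n∣m*n (suc m)))
        (+-congˡ (-‿cong (trans (reflexive (≡.cong (q ^_) (ℕ.*-comm (suc m) l))) (sym (^-assocʳ q l (suc m)))))))

    regularGF-euler : regularGF l * f ≈ euler (q ^ l)
    regularGF-euler = trans
      (⟶-unique (⟶-⊛ (boundedGF⟶ l) f⟶) (⟶-cong (λ k → sym (boundedGF-euler l k)) (∏<⟶∏ (multiples-convergent l))))
      (⟶-unique (⟶-subsequence (ℕ._* l) (λ m → ℕ.m≤m*n m l) (∏<⟶∏ (multiples-convergent l)))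
        (⟶-cong (λ m → sym (multiples-euler m)) (∏<⟶∏ (e-convergent (q ^ l) (q ^ l-1) (*-comm q (q ^ l-1))))))

  -- Links two forms of f₈: counting partitions yields a product in q^8, whereas the dissections use
  -- iterated substitution.
  VVF≈ : V (V F) ≈ euler (q ^ 8)
  VVF≈ = trans (V-cong (trans (V-euler (e-convergent (q * q) q refl) conv₄) (euler-cong Vq²)))
           (trans (V-euler (e-convergent q⁴ (q * q * q) q⁴≈) conv₈)
                  (euler-cong (trans V-q⁴ (solve 1 (λ q → q :* q :* (q :* q) :* (q :* q :* (q :* q)) := q :^ 8) refl q))))
    where
    q⁴≈ : q⁴ ≈ q * q * q * q
    q⁴≈ = sym (*-assoc (q * q) q q)
    Vq² : V (q * q) ≈ q⁴
    Vq² = trans (V-* q q) (*-cong V-q V-q)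
    conv₄ : Convergent (e (V (q * q)))
    conv₄ = e-convergent (V (q * q)) (q * q * q) (trans Vq² q⁴≈)
    conv₈ : Convergent (e (V q⁴))
    conv₈ = e-convergent (V q⁴) (q⁴ * (q * q * q)) (trans V-q⁴ (trans (*-congˡ q⁴≈) (sym (*-assoc q⁴ (q * q * q) q))))

  bipartitionGF : gf (B 2 8) * (f * f) ≈ F * V (V F)
  bipartitionGF = begin
    gf (B 2 8) * (f * f)
      ≈⟨ *-congʳ (trans (gf-cong (B≡length-convolution 2 8)) (gf-convolution (allRegularPartitions 2) (allRegularPartitions 8))) ⟩
    regularGF 2 * regularGF 8 * (f * f)
      ≈⟨ solve 3 (λ a b f → a :* b :* (f :* f) := a :* f :* (b :* f)) refl (regularGF 2) (regularGF 8) f ⟩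
    regularGF 2 * f * (regularGF 8 * f)
      ≈⟨ *-cong (trans (regularGF-euler 1) (euler-cong (*-congˡ (*-identityʳ q)))) (trans (regularGF-euler 7) (sym VVF≈)) ⟩
    F * V (V F) ∎

  B-vanishes : ι.⟦ + 11 ⟧ K.≈ K.0# → ∀ n {k} → 1 ≤ k → k ≤ 10 → ι.⟦ + B 2 8 (8 ℕ.* (11 ℕ.* n ℕ.+ k) ℕ.+ 7) ⟧ K.≈ K.0#
  B-vanishes 11≈0 n {suc r} _ r<10 = K.trans
    (K.reflexive (≡.cong (λ N → ι.⟦ + B 2 8 N ⟧) (index n r)))
    (section-odd³-vanishes 11≈0 bipartitionGF r<10 .at n)
    where
    -- The right side is the index obtained by unfolding the section modulo 11 inside three odd
    -- sections.
    index : ∀ n r → 8 ℕ.* (11 ℕ.* n ℕ.+ suc r) ℕ.+ 7 ≡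
                    1 ℕ.+ (1 ℕ.+ (1 ℕ.+ (suc r ℕ.+ n ℕ.* 11) ℕ.* 2) ℕ.* 2) ℕ.* 2
    index = ℕ-RingSolver.solve-∀

-- The integers modulo m

module Modular (m : ℤ) where

  infix 4 _≈_

  -- A record lets a and b be inferred from a proof; the bare divisibility of a - b would not
  -- determine them.
  record _≈_ (a b : ℤ) : Set where
    constructor congruent
    field difference : m ℤ∣.∣ a ℤ.- b

  reflexive : ∀ {a b} → a ≡ b → a ≈ b
  reflexive {a} ≡.refl = congruent (ℤ∣.divides (+ 0) (ℤ.+-inverseʳ a))

  sym : ∀ {a b} → a ≈ b → b ≈ a
  sym {a} {b} (congruent a≈b) = congruent (≡.subst (m ℤ∣.∣_) (swap a b) (ℤ∣.∣m⇒∣-m a≈b))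
    where
    swap : ∀ a b → ℤ.- (a ℤ.- b) ≡ b ℤ.- a
    swap = solve-∀

  trans : ∀ {a b c} → a ≈ b → b ≈ c → a ≈ c
  trans {a} {b} {c} (congruent a≈b) (congruent b≈c) =
    congruent (≡.subst (m ℤ∣.∣_) (glue a b c) (ℤ∣.∣m∣n⇒∣m+n a≈b b≈c))
    where
    glue : ∀ a b c → (a ℤ.- b) ℤ.+ (b ℤ.- c) ≡ a ℤ.- c
    glue = solve-∀

  +-cong : ∀ {a b c d} → a ≈ b → c ≈ d → a ℤ.+ c ≈ b ℤ.+ d
  +-cong {a} {b} {c} {d} (congruent a≈b) (congruent c≈d) =
    congruent (≡.subst (m ℤ∣.∣_) (merge a b c d) (ℤ∣.∣m∣n⇒∣m+n a≈b c≈d))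
    where
    merge : ∀ a b c d → (a ℤ.- b) ℤ.+ (c ℤ.- d) ≡ (a ℤ.+ c) ℤ.- (b ℤ.+ d)
    merge = solve-∀

  *-cong : ∀ {a b c d} → a ≈ b → c ≈ d → a ℤ.* c ≈ b ℤ.* d
  *-cong {a} {b} {c} {d} (congruent a≈b) (congruent c≈d) =
    congruent (≡.subst (m ℤ∣.∣_) (merge a b c d)
      (ℤ∣.∣m∣n⇒∣m+n (ℤ∣.∣n⇒∣m*n c a≈b) (ℤ∣.∣n⇒∣m*n b c≈d)))
    where
    merge : ∀ a b c d → c ℤ.* (a ℤ.- b) ℤ.+ b ℤ.* (c ℤ.- d) ≡ a ℤ.* c ℤ.- b ℤ.* d
    merge = solve-∀

  neg-cong : ∀ {a b} → a ≈ b → ℤ.- a ≈ ℤ.- b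
  neg-cong {a} {b} (congruent a≈b) = congruent (≡.subst (m ℤ∣.∣_) (distrib a b) (ℤ∣.∣m⇒∣-m a≈b))
    where
    distrib : ∀ a b → ℤ.- (a ℤ.- b) ≡ (ℤ.- a) ℤ.- (ℤ.- b)
    distrib = solve-∀

  ≈0⇒∣ : ∀ {a} → a ≈ + 0 → m ℤ∣.∣ a
  ≈0⇒∣ {a} (congruent a≈0) = ≡.subst (m ℤ∣.∣_) (ℤ.+-identityʳ a) a≈0

  -- Residue classes are integers under a coarser equality, so the ring laws are inherited from ℤ
  -- and reduction is the identity map.
  commutativeRing : CommutativeRing 0ℓ 0ℓ
  commutativeRing = record
    { Carrier = ℤ
    ; _≈_ = _≈_
    ; _+_ = ℤ._+_
    ; _*_ = ℤ._*_
    ; -_ = ℤ.-_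
    ; 0# = + 0
    ; 1# = + 1
    ; isCommutativeRing = record
      { isRing = record
        { +-isAbelianGroup = record
          { isGroup = record
            { isMonoid = record
              { isSemigroup = record
                { isMagma = record
                  { isEquivalence = record { refl = reflexive ≡.refl ; sym = sym ; trans = trans }
                  ; ∙-cong = +-cong
                  }
                ; assoc = λ a b c → reflexive (ℤ.+-assoc a b c)
                }
              ; identity = (λ a → reflexive (ℤ.+-identityˡ a)) , (λ a → reflexive (ℤ.+-identityʳ a))
              }
            ; inverse = (λ a → reflexive (ℤ.+-inverseˡ a)) , (λ a → reflexive (ℤ.+-inverseʳ a))
            ; ⁻¹-cong = neg-cong
            }
          ; comm = λ a b → reflexive (ℤ.+-comm a b)
          }
        ; *-cong = *-cong
        ; *-assoc = λ a b c → reflexive (ℤ.*-assoc a b c)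
        ; *-identity = (λ a → reflexive (ℤ.*-identityˡ a)) , (λ a → reflexive (ℤ.*-identityʳ a))
        ; distrib = (λ a b c → reflexive (ℤ.*-distribˡ-+ a b c)) , (λ a b c → reflexive (ℤ.*-distribʳ-+ a b c))
        }
      ; *-comm = λ a b → reflexive (ℤ.*-comm a b)
      }
    }

  reduction : ℤ.+-*-rawRing -Raw-AlmostCommutative⟶ fromCommutativeRing commutativeRing
  reduction = record
    { ⟦_⟧    = λ a → a
    ; +-homo = λ _ _ → reflexive ≡.refl
    ; *-homo = λ _ _ → reflexive ≡.refl
    ; -‿homo = λ _ → reflexive ≡.refl
    ; 0-homo = reflexive ≡.refl
    ; 1-homo = reflexive ≡.refl
    }

open import Data.Nat.Base using (_+_; _*_)

theorem1p6 : (n k : ℕ) → 1 ≤ k → k ≤ 10 → 11 ∣ B 2 8 (8 * (11 * n + k) + 7)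
theorem1p6 n k 1≤k k≤10 = ℤ∣.∣⇒∣ᵤ {+ 11} {+ B 2 8 (8 * (11 * n + k) + 7)} (ℤ/11.≈0⇒∣ B≈0)
  where
  module ℤ/11 = Modular (+ 11)

  B≈0 : + B 2 8 (8 * (11 * n + k) + 7) ℤ/11.≈ + 0
  B≈0 = Theta.B-vanishes ℤ/11.commutativeRing ℤ/11.reduction
          (ℤ/11.congruent (ℤ∣.divides (+ 1) ≡.refl)) n 1≤k k≤10
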